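{- Let $a=2^s$ with $s\ge1$ an integer, let $q=2^a+1$ be a Fermat prime, and let $p$ be a prime divisor of $2^a-1$. Suppose that $p=2^{2^l}+1$ is a Fermat prime for some $0\le l\le s-1$. Then the independence number of $\Gamma(a,p,\emptyset,\{0\})$ satisfies $\alpha(\Gamma(a,p,\emptyset,\{0\}))\le q$, with equality only if $l=s-1$ (that is, $p=2^{2^{s-1}}+1$).
   Context: $\Gamma(a,p,\emptyset,\{0\})$ is the Marušič-Scapellato graph with vertex set $(\mathrm{GF}(2^a)\cup\{\infty\})\times\mathbb{Z}_p$ in which, for a primitive element $w$ of $\mathrm{GF}(2^a)$, the neighbourhood of $(\infty,r)$ is $\{(x,r):x\in\mathrm{GF}(2^a)\}$, and the neighbourhood of $(x,r)$ with $x\in\mathrm{GF}(2^a)$ is $\{(\infty,r)\}\cup\{(x+w^i,-r+2i):i\in\mathbb{Z}_{2^a-1}\}$. -}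

module Defs where

open import Algebra.Bundles using (CommutativeRing; Semiring)
open import Algebra.Structures using (IsCommutativeRing)
import Algebra.Properties.AbelianGroup as AbelianGroupProperties
import Algebra.Properties.CommutativeMonoid.Sum as Sum
import Algebra.Properties.Semiring.Mult as Mult
open import Data.Empty using (⊥; ⊥-elim)
open import Data.Fin.Base using (Fin; zero; suc; toℕ)
open import Data.Fin.Permutation using (Permutation′; _⟨$⟩ʳ_)
open import Data.Fin.Properties
  using (_≟_; all?; any?; inj⇒≟; *↔×; toℕ<n; toℕ-fromℕ<; toℕ-injective)
open import Data.Fin.Subset using (Subset; ∣_∣; _∈_) renaming (⊥ to ∅)
open import Data.Fin.Subset.Properties using (∣p∣≤n; ∣⊥∣≡0; ∉⊥; _∈?_; anySubset?)
open import Data.Maybe.Base using (Maybe; just; nothing)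
open import Data.Nat.Base as ℕ using (ℕ; zero; suc; NonZero; _∸_; _≤_)
open import Data.Nat.DivMod
  using (_%_; _/_; _mod_; m%n<n; m≡m%n+[m/n]*n; [m+kn]%n≡m%n; m<n⇒m%n≡m)
import Data.Nat.Properties as ℕₚ
open import Data.Nat.Solver using (module +-*-Solver)
open import Data.Product.Base using (∃; _×_; _,_; proj₁)
open import Data.Product.Function.NonDependent.Propositional using (_×-↔_)
open import Function.Base using (_∘_)
open import Function.Bundles using (_↔_; Inverse; mk↔ₛ′)
import Function.Construct.Composition as Compose
import Function.Construct.Identity as Identity
import Function.Construct.Symmetry as Symmetry
open import Function.Properties.Inverse using (Inverse⇒Injection)
open import Relation.Binary.Definitions using (DecidableEquality)
open import Relation.Binary.PropositionalEquality
  using (_≡_; _≢_; refl; sym; trans; cong; cong₂; subst; module ≡-Reasoning)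
open import Relation.Nullary using (¬_; Dec; yes; no)
open import Relation.Nullary.Decidable using (¬?; _×-dec_; _→-dec_)

record FiniteSimpleGraph : Set₁ where
  field
    Vertex     : Set
    order      : ℕ
    enum       : Vertex ↔ Fin order
    Adj        : Vertex → Vertex → Set
    adj-sym    : ∀ {u v} → Adj u v → Adj v u
    adj-irrefl : ∀ {v} → ¬ Adj v v
    adj?       : ∀ u v → Dec (Adj u v)

  vertex : Fin order → Vertex
  vertex = Inverse.from enum

module _ (G : FiniteSimpleGraph) where
  open FiniteSimpleGraph G

  -- Sets of vertices are subsets of Fin order, along the bijection enum.
  Independent : Subset order → Set
  Independent S = ∀ i → i ∈ S → ∀ j → j ∈ S → ¬ Adj (vertex i) (vertex j)

  HasIndependentSetOfSize : ℕ → Set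
  HasIndependentSetOfSize k = ∃ λ S → Independent S × ∣ S ∣ ≡ k

  IsIndependenceNumber : ℕ → Set
  IsIndependenceNumber k =
    HasIndependentSetOfSize k × (∀ m → HasIndependentSetOfSize m → m ≤ k)

  private
    independent? : ∀ S → Dec (Independent S)
    independent? S = all? λ i → (i ∈? S) →-dec all? λ j →
      (j ∈? S) →-dec ¬? (adj? (vertex i) (vertex j))

    hasIndependentSetOfSize? : ∀ k → Dec (HasIndependentSetOfSize k)
    hasIndependentSetOfSize? k =
      anySubset? λ S → independent? S ×-dec (∣ S ∣ ℕₚ.≟ k)

    search : ∀ n → (∀ m → HasIndependentSetOfSize m → m ≤ n) →
             ∃ IsIndependenceNumber
    search n bound with hasIndependentSetOfSize? n
    ... | yes h = n , h , bound
    search zero bound | no ¬h =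
      ⊥-elim (¬h (∅ , (λ _ i∈∅ → ⊥-elim (∉⊥ i∈∅)) , ∣⊥∣≡0 order))
    search (suc n) bound | no ¬h = search n λ m h →
      ℕₚ.m<1+n⇒m≤n (ℕₚ.≤∧≢⇒< (bound m h)
        λ m≡1+n → ¬h (subst HasIndependentSetOfSize m≡1+n h))

  independenceNumber-exists : ∃ IsIndependenceNumber
  independenceNumber-exists =
    search order λ { m (S , _ , ∣S∣≡m) → subst (_≤ order) ∣S∣≡m (∣p∣≤n S) }

  α : ℕ
  α = proj₁ independenceNumber-exists

record FiniteField (n : ℕ) : Set₁ where
  infix  8 -_
  infixl 6 _+_
  infixl 7 _*_
  field
    Carrier           : Set
    _+_ _*_           : Carrier → Carrier → Carrier
    -_                : Carrier → Carrier
    0# 1#             : Carrier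
    isCommutativeRing : IsCommutativeRing _≡_ _+_ _*_ -_ 0# 1#
    0≢1               : 0# ≢ 1#
    inverse           : ∀ x → x ≢ 0# → ∃ λ y → x * y ≡ 1#
    enum              : Carrier ↔ Fin n

  commutativeRing : CommutativeRing _ _
  commutativeRing = record { isCommutativeRing = isCommutativeRing }

  open CommutativeRing commutativeRing public
    using (semiring; +-abelianGroup; +-commutativeMonoid
          ; +-assoc; +-comm; +-identityˡ; +-identityʳ; -‿inverseˡ; -‿inverseʳ
          ; *-assoc; *-comm; *-identityˡ; *-identityʳ; distribˡ; distribʳ
          ; zeroˡ; zeroʳ)
  open import Algebra.Definitions.RawSemiring (Semiring.rawSemiring semiring) public
    using (_^_)

  infix 4 _≟ᶠ_
  _≟ᶠ_ : DecidableEquality Carrier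
  _≟ᶠ_ = inj⇒≟ (Inverse⇒Injection enum)

  IsPrimitive : Carrier → Set
  IsPrimitive w = w ≢ 0# × (∀ x → x ≢ 0# → ∃ λ (i : ℕ) → x ≡ w ^ i)

  *-nonZero : ∀ {x y} → x ≢ 0# → x * y ≡ 0# → y ≡ 0#
  *-nonZero {x} {y} x≢0 xy≡0 with x⁻¹ , xx⁻¹≡1 ← inverse x x≢0 = begin
    y               ≡⟨ *-identityˡ y ⟨
    1# * y          ≡⟨ cong (_* y) (trans (*-comm x⁻¹ x) xx⁻¹≡1) ⟨
    x⁻¹ * x * y     ≡⟨ *-assoc x⁻¹ x y ⟩
    x⁻¹ * (x * y)   ≡⟨ cong (x⁻¹ *_) xy≡0 ⟩
    x⁻¹ * 0#        ≡⟨ zeroʳ x⁻¹ ⟩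
    0#              ∎
    where open ≡-Reasoning

  ^-nonZero : ∀ {x} i → x ≢ 0# → x ^ i ≢ 0#
  ^-nonZero zero    x≢0 1≡0 = 0≢1 (sym 1≡0)
  ^-nonZero (suc i) x≢0 eq  = ^-nonZero i x≢0 (*-nonZero x≢0 eq)

  +-cancelʳ′ : ∀ {x} y → x + y ≡ x → y ≡ 0#
  +-cancelʳ′ {x} y x+y≡x = AbelianGroupProperties.identityʳ-unique +-abelianGroup x y x+y≡x

  open Mult semiring public using () renaming (_×_ to _×ⁿ_)

  -- Translation by 1# permutes the elements, so it does not change their sum.
  order×1≡0 : n ×ⁿ 1# ≡ 0#
  order×1≡0 = +-cancelʳ′ {sum el} (n ×ⁿ 1#) (begin
    sum el + n ×ⁿ 1#                 ≡⟨ cong (sum el +_) (sum-replicate n) ⟨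
    sum el + sum {n} (λ _ → 1#)      ≡⟨ ∑-distrib-+ el (λ _ → 1#) ⟨
    sum (λ i → el i + 1#)            ≡⟨ sum-cong-≗ (λ i → sym (Inverse.strictlyInverseʳ enum (el i + 1#))) ⟩
    sum (λ i → el (shift ⟨$⟩ʳ i))    ≡⟨ sum-permute el shift ⟨
    sum el                           ∎)
    where
    open ≡-Reasoning
    open Sum +-commutativeMonoid using (sum; ∑-distrib-+; sum-permute; sum-cong-≗; sum-replicate)
    el : Fin n → Carrier
    el = Inverse.from enum
    translate : Carrier ↔ Carrier
    translate = mk↔ₛ′ (_+ 1#) (_+ - 1#)
      (λ x → trans (+-assoc x (- 1#) 1#) (trans (cong (x +_) (-‿inverseˡ 1#)) (+-identityʳ x)))
      (λ x → trans (+-assoc x 1# (- 1#)) (trans (cong (x +_) (-‿inverseʳ 1#)) (+-identityʳ x)))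
    shift : Permutation′ n
    shift = Compose.inverse (Symmetry.inverse enum) (Compose.inverse translate enum)

module _ (a : ℕ) (F : FiniteField (2 ℕ.^ a)) where
  open FiniteField F
  open Mult semiring using (×1-homo-*; ×-homo-1)

  private
    1+1≡0 : ∀ k → (2 ℕ.^ k) ×ⁿ 1# ≡ 0# → 1# + 1# ≡ 0#
    1+1≡0 zero    1≡0 = ⊥-elim (0≢1 (sym (trans (sym (+-identityʳ 1#)) 1≡0)))
    1+1≡0 (suc k) eq with 1# + 1# ≟ᶠ 0#
    ... | yes 2≡0 = 2≡0
    ... | no  2≢0 = 1+1≡0 k (*-nonZero (2≢0 ∘ trans (cong (1# +_) (sym (+-identityʳ 1#))))
                              (trans (sym (×1-homo-* 2 (2 ℕ.^ k))) eq))

  x+x≡0 : ∀ x → x + x ≡ 0#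
  x+x≡0 x = begin
    x + x             ≡⟨ cong₂ _+_ (*-identityʳ x) (*-identityʳ x) ⟨
    x * 1# + x * 1#   ≡⟨ distribˡ x 1# 1# ⟨
    x * (1# + 1#)     ≡⟨ cong (x *_) (1+1≡0 a order×1≡0) ⟩
    x * 0#            ≡⟨ zeroʳ x ⟩
    0#                ∎
    where open ≡-Reasoning

-- The element -r + 2i of ℤₚ, whose elements are represented by Fin p.
-r+2i : ∀ {p} .{{_ : NonZero p}} → Fin p → ℕ → Fin p
-r+2i {p} r i = ((p ∸ toℕ r) ℕ.+ 2 ℕ.* i) mod p

-r+2i-involutive : ∀ {p} .{{_ : NonZero p}} (r : Fin p) i → r ≡ -r+2i (-r+2i r i) i
-r+2i-involutive {p} r i = toℕ-injective (sym (begin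
  toℕ (-r+2i t i)                               ≡⟨ toℕ-fromℕ< (m%n<n (p ∸ toℕ t ℕ.+ c) p) ⟩
  (p ∸ toℕ t ℕ.+ c) % p                         ≡⟨ [m+kn]%n≡m%n _ 1 p ⟨
  (p ∸ toℕ t ℕ.+ c ℕ.+ 1 ℕ.* p) % p             ≡⟨ cong (_% p) lemma ⟩
  (toℕ r ℕ.+ (suc (X / p)) ℕ.* p) % p           ≡⟨ [m+kn]%n≡m%n (toℕ r) (suc (X / p)) p ⟩
  toℕ r % p                                     ≡⟨ m<n⇒m%n≡m (toℕ<n r) ⟩
  toℕ r                                         ∎))
  where
  open ≡-Reasoning
  c = 2 ℕ.* i
  t = -r+2i r i
  X = p ∸ toℕ r ℕ.+ c
  X≡ : X ≡ toℕ t ℕ.+ X / p ℕ.* p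
  X≡ = trans (m≡m%n+[m/n]*n X p) (cong (ℕ._+ X / p ℕ.* p) (sym (toℕ-fromℕ< (m%n<n X p))))
  r+ : ∀ (u : Fin p) → p ∸ toℕ u ℕ.+ toℕ u ≡ p
  r+ u = ℕₚ.m∸n+n≡m (ℕₚ.<⇒≤ (toℕ<n u))
  open +-*-Solver using (solve; _:+_; _:*_; con; _:=_)
  lemma : p ∸ toℕ t ℕ.+ c ℕ.+ 1 ℕ.* p ≡ toℕ r ℕ.+ suc (X / p) ℕ.* p
  lemma = begin
    p ∸ toℕ t ℕ.+ c ℕ.+ 1 ℕ.* p
      ≡⟨ cong (p ∸ toℕ t ℕ.+ c ℕ.+_) (trans (ℕₚ.*-identityˡ p) (sym (r+ r))) ⟩
    p ∸ toℕ t ℕ.+ c ℕ.+ (p ∸ toℕ r ℕ.+ toℕ r)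
      ≡⟨ solve 4 (λ A C B R → A :+ C :+ (B :+ R) := R :+ (A :+ (B :+ C))) refl
           (p ∸ toℕ t) c (p ∸ toℕ r) (toℕ r) ⟩
    toℕ r ℕ.+ (p ∸ toℕ t ℕ.+ X)
      ≡⟨ cong (λ y → toℕ r ℕ.+ (p ∸ toℕ t ℕ.+ y)) X≡ ⟩
    toℕ r ℕ.+ (p ∸ toℕ t ℕ.+ (toℕ t ℕ.+ X / p ℕ.* p))
      ≡⟨ cong (toℕ r ℕ.+_) (ℕₚ.+-assoc (p ∸ toℕ t) (toℕ t) (X / p ℕ.* p)) ⟨
    toℕ r ℕ.+ (p ∸ toℕ t ℕ.+ toℕ t ℕ.+ X / p ℕ.* p)
      ≡⟨ cong (λ y → toℕ r ℕ.+ (y ℕ.+ X / p ℕ.* p)) (r+ t) ⟩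
    toℕ r ℕ.+ suc (X / p) ℕ.* p ∎

module _ (a p : ℕ) .{{_ : NonZero p}} (F : FiniteField (2 ℕ.^ a))
         (w : FiniteField.Carrier F) where
  open FiniteField F

  -- nothing is the point ∞.
  Γ-Vertex : Set
  Γ-Vertex = Maybe Carrier × Fin p

  -- Γ-Adj u v says that v lies in the neighbourhood of u.  The exponent
  -- i ∈ ℤ_{2ᵃ-1} is given by its representative 0 ≤ i < 2ᵃ - 1.
  Γ-Adj : Γ-Vertex → Γ-Vertex → Set
  Γ-Adj (nothing , r) (nothing , t) = ⊥
  Γ-Adj (nothing , r) (just y  , t) = t ≡ r
  Γ-Adj (just x  , r) (nothing , t) = t ≡ r
  Γ-Adj (just x  , r) (just y  , t) =
    ∃ λ (i : Fin (2 ℕ.^ a ∸ 1)) → y ≡ x + w ^ toℕ i × t ≡ -r+2i r (toℕ i)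

  private
    adj-sym : ∀ {u v} → Γ-Adj u v → Γ-Adj v u
    adj-sym {nothing , _} {just _ , _}  eq = sym eq
    adj-sym {just _ , _}  {nothing , _} eq = sym eq
    adj-sym {just x , r}  {just _ , _}  (i , refl , refl) =
      i , sym (trans (+-assoc x _ _) (trans (cong (x +_) (x+x≡0 a F (w ^ toℕ i))) (+-identityʳ x)))
        , -r+2i-involutive r (toℕ i)

    adj-irrefl : w ≢ 0# → ∀ {v} → ¬ Γ-Adj v v
    adj-irrefl w≢0 {just x , r} (i , x≡x+wⁱ , _) =
      ^-nonZero (toℕ i) w≢0 (+-cancelʳ′ {x} (w ^ toℕ i) (sym x≡x+wⁱ))

    adj? : ∀ u v → Dec (Γ-Adj u v)
    adj? (nothing , r) (nothing , t) = no λ ()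
    adj? (nothing , r) (just y  , t) = t ≟ r
    adj? (just x  , r) (nothing , t) = t ≟ r
    adj? (just x  , r) (just y  , t) =
      any? λ i → (y ≟ᶠ x + w ^ toℕ i) ×-dec (t ≟ -r+2i r (toℕ i))

    maybe-enum : Maybe Carrier ↔ Fin (suc (2 ℕ.^ a))
    maybe-enum = mk↔ₛ′
      (λ { nothing → zero ; (just x) → suc (Inverse.to enum x) })
      (λ { zero → nothing ; (suc i) → just (Inverse.from enum i) })
      (λ { zero → refl ; (suc i) → cong suc (Inverse.strictlyInverseˡ enum i) })
      (λ { nothing → refl ; (just x) → cong just (Inverse.strictlyInverseʳ enum x) })

  -- Γ(a, p, ∅, {0}), relative to the chosen primitive element w.
  Γ : IsPrimitive w → FiniteSimpleGraph
  Γ (w≢0 , _) = record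
    { Vertex     = Γ-Vertex
    ; order      = suc (2 ℕ.^ a) ℕ.* p
    ; enum       = Compose.inverse (maybe-enum ×-↔ Identity.↔-id (Fin p))
                                   (Symmetry.inverse *↔×)
    ; Adj        = Γ-Adj
    ; adj-sym    = λ {u} {v} → adj-sym {u} {v}
    ; adj-irrefl = λ {v} → adj-irrefl w≢0 {v}
    ; adj?       = adj?
    }

-- The proof is a ratio bound obtained by double counting.  Put Q = 2ᵃ = R².  Any two fibres {x} × ℤₚ
-- are joined by a perfect matching, so Γ is Q-regular and two vertices of one fibre have no common
-- neighbour.  With points written in homogeneous coordinates, (x , r) and (y , t) are adjacent iff, up to
-- the sign of labels at ∞, r + t ≡ 2 log (det x y) mod p; hence a common neighbour of vertices over x ≢ x′
-- lies over a point y for which log (det x y / det x′ y) is in a fixed class mod p.  By the Plücker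
-- relation this ratio determines y, so there are at most (Q - 1) / p common neighbours.
--
-- For an independent set S of size m let d v be the number of neighbours of v in S.  Then d vanishes
-- on S, Σ d = Q m, and the codegrees bound Σ d² in terms of m and the fibre sizes of S.  The
-- Cauchy-Schwarz inequality, applied to d outside S and to the fibre sizes, yields
-- (R + 1) m ≤ p (Q + 1).  Finally p = 2^(2^l) + 1 ≤ 2^(2^(s-1)) + 1 = R + 1.
module Submission where

open import Defs
open import Data.Nat using (ℕ; NonZero; _+_; _∸_; _^_; _≤_)
open import Data.Nat.Divisibility using (_∣_)
open import Data.Nat.Primality using (Prime)
open import Data.Product using (_×_)
open import Relation.Binary.PropositionalEquality using (_≡_)

open import Algebra.Bundles using (CommutativeRing)
import Algebra.Properties.Semiring.Exp as Exp
import Algebra.Properties.Semiring.Sum as SemiringSum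
import Algebra.Solver.Ring.NaturalCoefficients.Default as Solver
open import Data.Bool.Base using (true; false; if_then_else_)
open import Data.Fin.Base using (Fin; zero; suc; toℕ; fromℕ<; punchIn; punchOut)
open import Data.Fin.Properties as Finₚ
  using (punchOut-injective; punchInᵢ≢i; toℕ<n; pigeonhole; injective⇒≤) renaming (_≟_ to _≟ᶠ_)
open import Data.Fin.Subset using (Subset; ∣_∣)
open import Data.Maybe.Base using (Maybe; just; nothing)
open import Data.Nat using (zero; suc; _*_; _<_; _≤?_; _≟_; z≤n; s≤s; s≤s⁻¹; ≢-nonZero; >-nonZero)
open import Data.Nat.Divisibility using (divides)
open import Data.Nat.DivMod using (_/_; _%_; _mod_; m%n<n; m≡m%n+[m/n]*n; [m+kn]%n≡m%n; m<n*o⇒m/o<n)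
open import Data.Nat.Properties as ℕₚ
  using (module ≤-Reasoning; ≤-trans; ≤-antisym; ≤-<-trans; <⇒≤; <⇒≱; <-cmp; n<1+n; m∸n≤m; m<n⇒0<n∸m; m+[n∸m]≡n)
open import Data.Nat.Tactic.RingSolver using (solve-∀)
open import Data.Product using (∃; _,_; proj₁; proj₂)
open import Data.Sum using (_⊎_; inj₁; inj₂)
open import Data.Vec.Base using (lookup; []; _∷_)
open import Data.Vec.Properties using (lookup⇒[]=)
open import Function using (_∘_; Inverse)
open import Relation.Binary.Definitions using (tri<; tri≈; tri>)
open import Relation.Binary.PropositionalEquality
  using (_≢_; refl; sym; trans; cong; cong₂; subst; subst₂; subst-subst-sym; subst-sym-subst; module ≡-Reasoning)
open import Relation.Nullary using (¬_; Dec; yes; no; contradiction)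
open import Relation.Nullary.Decidable using (_×-dec_)

open SemiringSum ℕₚ.+-*-semiring
  using (sum; sum-syntax; ∑-distrib-+; ∑-comm; sum-cong-≗; sum-replicate-zero; *-distribˡ-sum; *-distribʳ-sum)

-- Finite sums and the Cauchy-Schwarz inequality in ℕ.

∑-mono-≤ : ∀ {n} {f g : Fin n → ℕ} → (∀ i → f i ≤ g i) → sum f ≤ sum g
∑-mono-≤ {zero}  f≤g = z≤n
∑-mono-≤ {suc n} f≤g = ℕₚ.+-mono-≤ (f≤g zero) (∑-mono-≤ (f≤g ∘ suc))

∑-replicate : ∀ n c → ∑[ i < n ] c ≡ n * c
∑-replicate zero    c = refl
∑-replicate (suc n) c = cong (c +_) (∑-replicate n c)

∑*∑ : ∀ {m n} (f : Fin m → ℕ) (g : Fin n → ℕ) →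
      sum f * sum g ≡ ∑[ i < m ] ∑[ j < n ] (f i * g j)
∑*∑ f g = trans (*-distribʳ-sum (sum g) f) (sum-cong-≗ λ i → *-distribˡ-sum (f i) g)

∑∑-distrib-+ : ∀ {m n} (f g : Fin m → Fin n → ℕ) →
  ∑[ i < m ] ∑[ j < n ] (f i j + g i j) ≡
  ∑[ i < m ] ∑[ j < n ] f i j + ∑[ i < m ] ∑[ j < n ] g i j
∑∑-distrib-+ {m} {n} f g =
  trans (sum-cong-≗ λ i → ∑-distrib-+ (f i) (g i)) (∑-distrib-+ (λ i → sum (f i)) (λ i → sum (g i)))

*-distribˡ-∑∑ : ∀ {m n} c (f : Fin m → Fin n → ℕ) →
  c * ∑[ i < m ] ∑[ j < n ] f i j ≡ ∑[ i < m ] ∑[ j < n ] (c * f i j)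
*-distribˡ-∑∑ c f =
  trans (*-distribˡ-sum c (λ i → sum (f i))) (sum-cong-≗ λ i → *-distribˡ-sum c (f i))

2xy≤x²+y² : ∀ x y → x * y + x * y ≤ x * x + y * y
2xy≤x²+y² x y with ℕₚ.≤-total x y
... | inj₁ x≤y with k , refl ← ℕₚ.m≤n⇒∃[o]m+o≡n x≤y =
  subst (x * (x + k) + x * (x + k) ≤_) (lemma x k) (ℕₚ.m≤m+n _ (k * k))
  where
  lemma : ∀ x k → x * (x + k) + x * (x + k) + k * k ≡ x * x + (x + k) * (x + k)
  lemma = solve-∀
... | inj₂ y≤x with k , refl ← ℕₚ.m≤n⇒∃[o]m+o≡n y≤x =
  subst ((y + k) * y + (y + k) * y ≤_) (lemma y k) (ℕₚ.m≤m+n _ (k * k))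
  where
  lemma : ∀ y k → (y + k) * y + (y + k) * y + k * k ≡ (y + k) * (y + k) + y * y
  lemma = solve-∀

-- Summing `2xy≤x²+y²` with x = `t i * d j` and y = `d i * t j` over all pairs (i , j) gives twice
-- the claim.
cauchySchwarz : ∀ {n} (t d : Fin n → ℕ) →
  (∑[ i < n ] (t i * d i)) * (∑[ i < n ] (t i * d i)) ≤
  (∑[ i < n ] (t i * t i)) * (∑[ i < n ] (d i * d i))
cauchySchwarz {n} t d = ℕₚ.*-cancelˡ-≤ 2 (begin
  2 * (X * X)                                                       ≡⟨ double (X * X) ⟩
  X * X + X * X                                                     ≡⟨ cong₂ _+_ (∑*∑ f f) (∑*∑ f f) ⟩
  ∑[ i < n ] ∑[ j < n ] (f i * f j) + ∑[ i < n ] ∑[ j < n ] (f i * f j)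
    ≡⟨ ∑∑-distrib-+ (λ i j → f i * f j) (λ i j → f i * f j) ⟨
  ∑[ i < n ] ∑[ j < n ] (f i * f j + f i * f j)
    ≤⟨ ∑-mono-≤ (λ i → ∑-mono-≤ λ j → pointwise (t i) (d i) (t j) (d j)) ⟩
  ∑[ i < n ] ∑[ j < n ] (t i * t i * (d j * d j) + d i * d i * (t j * t j))
    ≡⟨ ∑∑-distrib-+ (λ i j → t i * t i * (d j * d j)) (λ i j → d i * d i * (t j * t j)) ⟩
  ∑[ i < n ] ∑[ j < n ] (t i * t i * (d j * d j)) + ∑[ i < n ] ∑[ j < n ] (d i * d i * (t j * t j))
    ≡⟨ cong₂ _+_ (∑*∑ (λ i → t i * t i) (λ i → d i * d i)) (∑*∑ (λ i → d i * d i) (λ i → t i * t i)) ⟨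
  T * D + D * T                                                     ≡⟨ cong (T * D +_) (ℕₚ.*-comm D T) ⟩
  T * D + T * D                                                     ≡⟨ double (T * D) ⟨
  2 * (T * D)                                                       ∎)
  where
  open ≤-Reasoning
  f : Fin n → ℕ
  f i = t i * d i
  X = ∑[ i < n ] (t i * d i)
  T = ∑[ i < n ] (t i * t i)
  D = ∑[ i < n ] (d i * d i)
  double : ∀ x → 2 * x ≡ x + x
  double = solve-∀
  pointwise : ∀ a b c e → a * b * (c * e) + a * b * (c * e) ≤ a * a * (e * e) + b * b * (c * c)
  pointwise a b c e = subst₂ _≤_ (eq₁ a b c e) (eq₂ a b c e) (2xy≤x²+y² (a * e) (b * c))
    where
    eq₁ : ∀ a b c e → a * e * (b * c) + a * e * (b * c) ≡ a * b * (c * e) + a * b * (c * e)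
    eq₁ = solve-∀
    eq₂ : ∀ a b c e → a * e * (a * e) + b * c * (b * c) ≡ a * a * (e * e) + b * b * (c * c)
    eq₂ = solve-∀

-- Expanding the squares and moving the sum over `j` innermost leaves a quadratic form in `s`; its
-- coefficients are codegrees when `X` is an adjacency matrix.
∑-square : ∀ {k n} (X : Fin k → Fin n → ℕ) (s : Fin n → ℕ) →
  ∑[ j < k ] ((∑[ u < n ] (X j u * s u)) * (∑[ u < n ] (X j u * s u))) ≡
  ∑[ u < n ] ∑[ v < n ] (s u * s v * ∑[ j < k ] (X j u * X j v))
∑-square {k} {n} X s = begin
  ∑[ j < k ] ((∑[ u < n ] (X j u * s u)) * (∑[ u < n ] (X j u * s u)))
    ≡⟨ sum-cong-≗ (λ j → ∑*∑ (λ u → X j u * s u) (λ u → X j u * s u)) ⟩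
  ∑[ j < k ] ∑[ u < n ] ∑[ v < n ] (X j u * s u * (X j v * s v))
    ≡⟨ ∑-comm (λ j u → ∑[ v < n ] (X j u * s u * (X j v * s v))) ⟩
  ∑[ u < n ] ∑[ j < k ] ∑[ v < n ] (X j u * s u * (X j v * s v))
    ≡⟨ sum-cong-≗ (λ u → ∑-comm (λ j v → X j u * s u * (X j v * s v))) ⟩
  ∑[ u < n ] ∑[ v < n ] ∑[ j < k ] (X j u * s u * (X j v * s v))
    ≡⟨ sum-cong-≗ (λ u → sum-cong-≗ λ v → trans
         (sum-cong-≗ λ j → rearrange (X j u) (s u) (X j v) (s v))
         (sym (*-distribˡ-sum (s u * s v) (λ j → X j u * X j v)))) ⟩
  ∑[ u < n ] ∑[ v < n ] (s u * s v * ∑[ j < k ] (X j u * X j v)) ∎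
  where
  open ≡-Reasoning
  rearrange : ∀ x a y b → x * a * (y * b) ≡ a * b * (x * y)
  rearrange = solve-∀

-- The ratio bound for independent sets, from degrees and codegrees.

square-cancel-≤ : ∀ {x y} → x * x ≤ y * y → x ≤ y
square-cancel-≤ {x} {y} x²≤y² with x ≤? y
... | yes x≤y = x≤y
... | no  x≰y = contradiction x²≤y² (<⇒≱ (ℕₚ.*-mono-< (ℕₚ.≰⇒> x≰y) (ℕₚ.≰⇒> x≰y)))

⟦_⟧ : ∀ {P : Set} → Dec P → ℕ
⟦ yes _ ⟧ = 1
⟦ no  _ ⟧ = 0

-- D and F stand for the sums of the squares of d and of the fibre sizes, k for the size of the
-- complement of the independent set, and h for Q - 1.
combine-estimates : ∀ {R h p q m k D F} → let Q = suc h in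
  Q ≡ R * R → q ≡ suc Q → p * q ≡ m + k →
  (Q * m) * (Q * m) ≤ k * D →
  m * m ≤ q * F →
  p * D + h * F ≤ h * (m * m) + p * Q * m →
  .{{_ : NonZero m}} →
  suc R * m ≤ p * q
combine-estimates {R} {h} {p} {q} {m} {k} {D} {F} Q≡R² refl pq≡m+k CS₁ CS₂ bound = begin
  suc R * m  ≡⟨⟩
  m + R * m  ≤⟨ ℕₚ.+-monoʳ-≤ m (square-cancel-≤ Rm²≤k²) ⟩
  m + k      ≡⟨ pq≡m+k ⟨
  p * q      ∎
  where
  open ≤-Reasoning
  Q = suc h
  -- Eliminates `F`: with `h * (q * F)` added to both sides, `CS₂` absorbs the leftover
  -- `h * (m * m)`, which arises from q = Q + 1.
  upper : p * q * D ≤ Q * m * (h * m + p * q)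
  upper = ℕₚ.+-cancelʳ-≤ (h * (q * F)) _ _ (begin
    p * q * D + h * (q * F)               ≡⟨ e₁ p q D h F ⟩
    q * (p * D + h * F)                   ≤⟨ ℕₚ.*-monoʳ-≤ q bound ⟩
    q * (h * (m * m) + p * Q * m)         ≡⟨ e₂ h m p ⟩
    Q * m * (h * m + p * q) + h * (m * m) ≤⟨ ℕₚ.+-monoʳ-≤ (Q * m * (h * m + p * q)) (ℕₚ.*-monoʳ-≤ h CS₂) ⟩
    Q * m * (h * m + p * q) + h * (q * F) ∎)
    where
    e₁ : ∀ p q D h F → p * q * D + h * (q * F) ≡ q * (p * D + h * F)
    e₁ = solve-∀
    e₂ : ∀ h m p → suc (suc h) * (h * (m * m) + p * suc h * m) ≡ suc h * m * (h * m + p * suc (suc h)) + h * (m * m)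
    e₂ = solve-∀
  P = p * q
  -- Now `CS₁` eliminates `D`. The factor `Q * m` is kept on both sides for cancellation, which
  -- needs `m` nonzero.
  main : Q * m * (Q * m * P) ≤ Q * m * (k * (h * m + P))
  main = begin
    Q * m * (Q * m * P)       ≡⟨ e₁ (Q * m) P ⟩
    P * (Q * m * (Q * m))     ≤⟨ ℕₚ.*-monoʳ-≤ P CS₁ ⟩
    P * (k * D)               ≡⟨ e₂ P k D ⟩
    k * (P * D)               ≤⟨ ℕₚ.*-monoʳ-≤ k upper ⟩
    k * (Q * m * (h * m + P)) ≡⟨ e₃ k (Q * m) (h * m + P) ⟩
    Q * m * (k * (h * m + P)) ∎
    where
    e₁ : ∀ x P → x * (x * P) ≡ P * (x * x)
    e₁ = solve-∀
    e₂ : ∀ P k D → P * (k * D) ≡ k * (P * D)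
    e₂ = solve-∀
    e₃ : ∀ k x y → k * (x * y) ≡ x * (k * y)
    e₃ = solve-∀
  instance
    Qm≢0 : NonZero (Q * m)
    Qm≢0 = ℕₚ.m*n≢0 Q m
  reduced : Q * m * (m + k) ≤ k * (h * m + (m + k))
  reduced = subst (λ P → Q * m * P ≤ k * (h * m + P)) pq≡m+k (ℕₚ.*-cancelˡ-≤ (Q * m) main)
  -- Since h + 1 = Q, both sides of `reduced` contain `Q * m * k`; removing it leaves Q m² ≤ k².
  Rm²≤k² : R * m * (R * m) ≤ k * k
  Rm²≤k² = ℕₚ.+-cancelʳ-≤ (Q * m * k) _ _ (begin
    R * m * (R * m) + Q * m * k ≡⟨ cong (_+ Q * m * k) (trans (e₁ R m) (cong (λ Q → Q * m * m) (sym Q≡R²))) ⟩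
    Q * m * m + Q * m * k       ≡⟨ ℕₚ.*-distribˡ-+ (Q * m) m k ⟨
    Q * m * (m + k)             ≤⟨ reduced ⟩
    k * (h * m + (m + k))       ≡⟨ e₂ k h m ⟩
    k * k + Q * m * k           ∎)
    where
    e₁ : ∀ R m → R * m * (R * m) ≡ R * R * m * m
    e₁ = solve-∀
    e₂ : ∀ k h m → k * (h * m + (m + k)) ≡ k * k + suc h * m * k
    e₂ = solve-∀

∑-indicator : ∀ {n} (u : Fin n) (f : Fin n → ℕ) → ∑[ v < n ] (⟦ u ≟ᶠ v ⟧ * f v) ≡ f u
∑-indicator {suc n} zero f =
  trans (cong₂ _+_ (ℕₚ.*-identityˡ (f zero)) (sum-replicate-zero n)) (ℕₚ.+-identityʳ (f zero))
∑-indicator (suc u) f =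
  trans (sum-cong-≗ λ v → cong (_* f (suc v)) (⟦suc≟suc⟧ u v)) (∑-indicator u (f ∘ suc))
  where
  ⟦suc≟suc⟧ : ∀ {n} (u v : Fin n) → ⟦ suc u ≟ᶠ suc v ⟧ ≡ ⟦ u ≟ᶠ v ⟧
  ⟦suc≟suc⟧ u v with u ≟ᶠ v
  ... | yes _ = refl
  ... | no  _ = refl

-- A is the adjacency matrix of a regular graph, B the incidence matrix of a partition into k blocks and
-- s the indicator of an independent set.  The hypothesis codeg covers u ≡ v, distinct vertices in one
-- block and vertices in different blocks by a single inequality.
module IndependentSet
  {n k R h p : ℕ} (A : Fin n → Fin n → ℕ) (B : Fin k → Fin n → ℕ) (s : Fin n → ℕ)
  (1+h≡R² : suc h ≡ R * R) (k≡2+h : k ≡ suc (suc h)) (pk≡n : p * k ≡ n)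
  (deg : ∀ u → ∑[ v < n ] A v u ≡ suc h)
  (block : ∀ u → ∑[ j < k ] B j u ≡ 1)
  (codeg : ∀ u v → p * (∑[ x < n ] (A x u * A x v)) + h * (∑[ j < k ] (B j u * B j v)) ≤
                   h + p * suc h * ⟦ u ≟ᶠ v ⟧)
  (s∈01 : ∀ u → s u ≡ 0 ⊎ s u ≡ 1)
  (independent : ∀ u v → s u ≡ 1 → s v ≡ 1 → A u v ≡ 0)
  where

  private
    Q m D F K : ℕ
    Q = suc h
    m = sum s
    d t : Fin n → ℕ
    d v = ∑[ u < n ] (A v u * s u)
    t v = 1 ∸ s v
    b : Fin k → ℕ
    b j = ∑[ u < n ] (B j u * s u)
    D = ∑[ v < n ] (d v * d v)
    F = ∑[ j < k ] (b j * b j)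
    K = sum t

    n≡m+K : n ≡ m + K
    n≡m+K = begin
      n                        ≡⟨ trans (∑-replicate n 1) (ℕₚ.*-identityʳ n) ⟨
      ∑[ v < n ] 1             ≡⟨ sum-cong-≗ (λ v → sym (s+t v)) ⟩
      ∑[ v < n ] (s v + t v)   ≡⟨ ∑-distrib-+ s t ⟩
      m + K                    ∎
      where
      open ≡-Reasoning
      s+t : ∀ v → s v + t v ≡ 1
      s+t v with s v | s∈01 v
      ... | _ | inj₁ refl = refl
      ... | _ | inj₂ refl = refl

    -- Double counting; the column sum `c` is Q for the adjacency matrix and 1 for the block
    -- incidences.
    ∑-weighted : ∀ {l c} (X : Fin l → Fin n → ℕ) → (∀ u → ∑[ j < l ] X j u ≡ c) →
                 ∑[ j < l ] ∑[ u < n ] (X j u * s u) ≡ c * m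
    ∑-weighted {l} {c} X colsum = begin
      ∑[ j < l ] ∑[ u < n ] (X j u * s u)   ≡⟨ ∑-comm (λ j u → X j u * s u) ⟩
      ∑[ u < n ] ∑[ j < l ] (X j u * s u)
        ≡⟨ sum-cong-≗ (λ u → trans (sym (*-distribʳ-sum (s u) (λ j → X j u))) (cong (_* s u) (colsum u))) ⟩
      ∑[ u < n ] (c * s u)                  ≡⟨ *-distribˡ-sum c s ⟨
      c * m                                 ∎
      where open ≡-Reasoning

    -- A vertex of the independent set has no neighbour in it, so `d` vanishes wherever `t` does.
    -- This lets `CS₁` have the factor `K`, the size of the complement, in place of `n`.
    td≡d : ∀ v → t v * d v ≡ d v
    td≡d v with s∈01 v
    ... | inj₁ sv≡0 = trans (cong (λ x → (1 ∸ x) * d v) sv≡0) (ℕₚ.*-identityˡ (d v))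
    ... | inj₂ sv≡1 = trans (cong (λ x → (1 ∸ x) * d v) sv≡1) (sym dv≡0)
      where
      term≡0 : ∀ u → A v u * s u ≡ 0
      term≡0 u with s∈01 u
      ... | inj₁ su≡0 = trans (cong (A v u *_) su≡0) (ℕₚ.*-zeroʳ (A v u))
      ... | inj₂ su≡1 = cong (_* s u) (independent v u sv≡1 su≡1)
      dv≡0 : d v ≡ 0
      dv≡0 = trans (sum-cong-≗ term≡0) (sum-replicate-zero n)

    tt≡t : ∀ v → t v * t v ≡ t v
    tt≡t v with s v | s∈01 v
    ... | _ | inj₁ refl = refl
    ... | _ | inj₂ refl = refl

    CS₁ : (Q * m) * (Q * m) ≤ K * D
    CS₁ = subst₂ (λ X T → X * X ≤ T * D)
      (trans (sum-cong-≗ td≡d) (∑-weighted A deg)) (sum-cong-≗ tt≡t) (cauchySchwarz t d)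

    CS₂ : m * m ≤ k * F
    CS₂ = subst₂ (λ X T → X * X ≤ T * F)
      (trans (sum-cong-≗ (λ j → ℕₚ.*-identityˡ (b j))) (trans (∑-weighted B block) (ℕₚ.*-identityˡ m)))
      (trans (∑-replicate k 1) (ℕₚ.*-identityʳ k)) (cauchySchwarz (λ _ → 1) b)

    -- `D` and `F` are quadratic forms in `s`, so `codeg` applies to each pair (u , v) with weight
    -- `s u * s v`. The constant `h` contributes `h * (m * m)` and the diagonal `p * Q * m`.
    bound : p * D + h * F ≤ h * (m * m) + p * Q * m
    bound = begin
      p * D + h * F
        ≡⟨ cong₂ (λ x y → p * x + h * y) (∑-square A s) (∑-square B s) ⟩
      p * (∑[ u < n ] ∑[ v < n ] (s u * s v * A² u v)) + h * (∑[ u < n ] ∑[ v < n ] (s u * s v * B² u v))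
        ≡⟨ cong₂ _+_ (*-distribˡ-∑∑ p (λ u v → s u * s v * A² u v)) (*-distribˡ-∑∑ h (λ u v → s u * s v * B² u v)) ⟩
      ∑[ u < n ] ∑[ v < n ] (p * (s u * s v * A² u v)) + ∑[ u < n ] ∑[ v < n ] (h * (s u * s v * B² u v))
        ≡⟨ ∑∑-distrib-+ (λ u v → p * (s u * s v * A² u v)) (λ u v → h * (s u * s v * B² u v)) ⟨
      ∑[ u < n ] ∑[ v < n ] (p * (s u * s v * A² u v) + h * (s u * s v * B² u v))
        ≤⟨ ∑-mono-≤ (λ u → ∑-mono-≤ λ v → pointwise u v) ⟩
      ∑[ u < n ] ∑[ v < n ] (h * (s u * s v) + p * Q * (s u * (⟦ u ≟ᶠ v ⟧ * s v)))
        ≡⟨ ∑∑-distrib-+ (λ u v → h * (s u * s v)) (λ u v → p * Q * (s u * (⟦ u ≟ᶠ v ⟧ * s v))) ⟩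
      ∑[ u < n ] ∑[ v < n ] (h * (s u * s v)) + ∑[ u < n ] ∑[ v < n ] (p * Q * (s u * (⟦ u ≟ᶠ v ⟧ * s v)))
        ≡⟨ cong₂ _+_ (*-distribˡ-∑∑ h (λ u v → s u * s v)) (*-distribˡ-∑∑ (p * Q) (λ u v → s u * (⟦ u ≟ᶠ v ⟧ * s v))) ⟨
      h * (∑[ u < n ] ∑[ v < n ] (s u * s v)) + p * Q * (∑[ u < n ] ∑[ v < n ] (s u * (⟦ u ≟ᶠ v ⟧ * s v)))
        ≡⟨ cong₂ (λ x y → h * x + p * Q * y) (sym (∑*∑ s s)) (sum-cong-≗ diagonal) ⟩
      h * (m * m) + p * Q * m ∎
      where
      open ≤-Reasoning
      A² B² : Fin n → Fin n → ℕ
      A² u v = ∑[ x < n ] (A x u * A x v)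
      B² u v = ∑[ j < k ] (B j u * B j v)
      diagonal : ∀ u → ∑[ v < n ] (s u * (⟦ u ≟ᶠ v ⟧ * s v)) ≡ s u
      diagonal u = trans (sym (*-distribˡ-sum (s u) (λ v → ⟦ u ≟ᶠ v ⟧ * s v)))
        (trans (cong (s u *_) (∑-indicator u s)) ss≡s)
        where
        ss≡s : s u * s u ≡ s u
        ss≡s with s u | s∈01 u
        ... | _ | inj₁ refl = refl
        ... | _ | inj₂ refl = refl
      pointwise : ∀ u v → p * (s u * s v * A² u v) + h * (s u * s v * B² u v) ≤
                          h * (s u * s v) + p * Q * (s u * (⟦ u ≟ᶠ v ⟧ * s v))
      pointwise u v = subst₂ _≤_ (e₁ p h (s u) (s v) (A² u v) (B² u v))
        (e₂ p h Q (s u) (s v) ⟦ u ≟ᶠ v ⟧) (ℕₚ.*-monoʳ-≤ (s u * s v) (codeg u v))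
        where
        e₁ : ∀ p h a b x y → a * b * (p * x + h * y) ≡ p * (a * b * x) + h * (a * b * y)
        e₁ = solve-∀
        e₂ : ∀ p h q a b i → a * b * (h + p * q * i) ≡ h * (a * b) + p * q * (a * (i * b))
        e₂ = solve-∀

  ratioBound : suc R * sum s ≤ p * k
  ratioBound with m ≟ 0
  -- The empty set is treated apart because `combine-estimates` cancels `Q * m`.
  ... | yes m≡0 = subst (λ x → suc R * x ≤ p * k) (sym m≡0) (subst (_≤ p * k) (sym (ℕₚ.*-zeroʳ (suc R))) z≤n)
  ... | no  m≢0 =
    combine-estimates {R} {h} {p} {k} {m} {K} {D} {F} 1+h≡R² k≡2+h (trans pk≡n n≡m+K) CS₁ CS₂ bound {{≢-nonZero m≢0}}

-- Counting by injections.

count-≤ : ∀ {n k} {P : Fin n → Set} (P? : ∀ i → Dec (P i)) (f : ∀ i → P i → Fin k) →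
          (∀ {i j} p q → f i p ≡ f j q → i ≡ j) → ∑[ i < n ] ⟦ P? i ⟧ ≤ k
count-≤ {zero}  P? f f-inj = z≤n
count-≤ {suc n} P? f f-inj with P? zero
... | no  _ = count-≤ (P? ∘ suc) (f ∘ suc) (λ p q → Finₚ.suc-injective ∘ f-inj p q)
count-≤ {suc n} {zero}  P? f f-inj | yes p₀ = contradiction (f zero p₀) λ ()
-- Injectivity keeps all later values away from that at `zero`, so the latter can be punched out of
-- the codomain.
count-≤ {suc n} {suc k} P? f f-inj | yes p₀ =
  s≤s (count-≤ (P? ∘ suc) (λ i p → punchOut (f₀≢f p))
    (λ p q → Finₚ.suc-injective ∘ f-inj p q ∘ punchOut-injective (f₀≢f p) (f₀≢f q)))
  where
  f₀≢f : ∀ {i} p → f zero p₀ ≢ f (suc i) p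
  f₀≢f p eq with () ← f-inj p₀ p eq

∑-indicator-1 : ∀ {n} (u : Fin n) → ∑[ v < n ] ⟦ u ≟ᶠ v ⟧ ≡ 1
∑-indicator-1 u = trans (sum-cong-≗ λ v → sym (ℕₚ.*-identityʳ ⟦ u ≟ᶠ v ⟧)) (∑-indicator u (λ _ → 1))

-- Double counting of the pairs with `g j ≡ i`: each `j` lies in exactly one, each `i` in at most
-- one, and in none unless `P i`.
count-≥ : ∀ {n k} {P : Fin n → Set} (P? : ∀ i → Dec (P i)) (g : Fin k → Fin n) →
          (∀ {i j} → g i ≡ g j → i ≡ j) → (∀ j → P (g j)) → k ≤ ∑[ i < n ] ⟦ P? i ⟧
count-≥ {n} {k} P? g g-inj Pg = begin
  k                                        ≡⟨ trans (∑-replicate k 1) (ℕₚ.*-identityʳ k) ⟨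
  ∑[ j < k ] 1                             ≡⟨ sum-cong-≗ (λ j → sym (∑-indicator-1 (g j))) ⟩
  ∑[ j < k ] ∑[ i < n ] ⟦ g j ≟ᶠ i ⟧       ≡⟨ ∑-comm (λ j i → ⟦ g j ≟ᶠ i ⟧) ⟩
  ∑[ i < n ] ∑[ j < k ] ⟦ g j ≟ᶠ i ⟧       ≤⟨ ∑-mono-≤ fibre ⟩
  ∑[ i < n ] ⟦ P? i ⟧                      ∎
  where
  open ≤-Reasoning
  fibre : ∀ i → ∑[ j < k ] ⟦ g j ≟ᶠ i ⟧ ≤ ⟦ P? i ⟧
  fibre i with P? i
  ... | yes _  = count-≤ (λ j → g j ≟ᶠ i) (λ _ _ → zero) (λ p q _ → g-inj (trans p (sym q)))
  ... | no ¬Pi = count-≤ (λ j → g j ≟ᶠ i) (λ j gj≡i → contradiction (subst _ gj≡i (Pg j)) ¬Pi)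
                   (λ {j} gj≡i _ _ → contradiction (subst _ gj≡i (Pg j)) ¬Pi)

⟦⟧-×-dec : ∀ {P Q : Set} (P? : Dec P) (Q? : Dec Q) → ⟦ P? ⟧ * ⟦ Q? ⟧ ≡ ⟦ P? ×-dec Q? ⟧
⟦⟧-×-dec (yes _) (yes _) = refl
⟦⟧-×-dec (yes _) (no _)  = refl
⟦⟧-×-dec (no _)  _       = refl

-- Congruences modulo p.

infix 4 _≅_[mod_]
-- Multiples of `p` are allowed on both sides, which avoids subtraction in ℕ.
record _≅_[mod_] (x y p : ℕ) : Set where
  constructor congruent
  field
    k l : ℕ
    eq  : x + k * p ≡ y + l * p

module _ {p : ℕ} where

  mod-reflexive : ∀ {x y} → x ≡ y → x ≅ y [mod p ]
  mod-reflexive eq = congruent 0 0 (cong (_+ 0) eq)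

  mod-refl : ∀ {x} → x ≅ x [mod p ]
  mod-refl = mod-reflexive refl

  mod-trans : ∀ {x y z} → x ≅ y [mod p ] → y ≅ z [mod p ] → x ≅ z [mod p ]
  mod-trans {x} {y} {z} (congruent k l eq) (congruent k′ l′ eq′) = congruent (k + k′) (l + l′) (begin
    x + (k + k′) * p       ≡⟨ expand x k k′ p ⟩
    x + k * p + k′ * p     ≡⟨ cong (_+ k′ * p) eq ⟩
    y + l * p + k′ * p     ≡⟨ swap y (l * p) (k′ * p) ⟩
    y + k′ * p + l * p     ≡⟨ cong (_+ l * p) eq′ ⟩
    z + l′ * p + l * p     ≡⟨ swap z (l′ * p) (l * p) ⟩
    z + l * p + l′ * p     ≡⟨ expand z l l′ p ⟨
    z + (l + l′) * p       ∎)
    where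
    open ≡-Reasoning
    expand : ∀ x k l p → x + (k + l) * p ≡ x + k * p + l * p
    expand = solve-∀
    swap : ∀ x y z → x + y + z ≡ x + z + y
    swap = solve-∀

  mod-sym : ∀ {x y} → x ≅ y [mod p ] → y ≅ x [mod p ]
  mod-sym (congruent k l eq) = congruent l k (sym eq)

  mod-+ : ∀ {x y x′ y′} → x ≅ y [mod p ] → x′ ≅ y′ [mod p ] → x + x′ ≅ y + y′ [mod p ]
  mod-+ {x} {y} {x′} {y′} (congruent k l eq) (congruent k′ l′ eq′) = congruent (k + k′) (l + l′) (begin
    x + x′ + (k + k′) * p       ≡⟨ swap x x′ k k′ p ⟩
    x + k * p + (x′ + k′ * p)   ≡⟨ cong₂ _+_ eq eq′ ⟩
    y + l * p + (y′ + l′ * p)   ≡⟨ swap y y′ l l′ p ⟨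
    y + y′ + (l + l′) * p       ∎)
    where
    open ≡-Reasoning
    swap : ∀ a b c d p → a + b + (c + d) * p ≡ a + c * p + (b + d * p)
    swap = solve-∀

  mod-cancelʳ : ∀ {x y} z → x + z ≅ y + z [mod p ] → x ≅ y [mod p ]
  mod-cancelʳ {x} {y} z (congruent k l eq) = congruent k l (ℕₚ.+-cancelʳ-≡ z _ _ (begin
    x + k * p + z   ≡⟨ swap x (k * p) z ⟩
    x + z + k * p   ≡⟨ eq ⟩
    y + z + l * p   ≡⟨ swap y (l * p) z ⟨
    y + l * p + z   ∎))
    where
    open ≡-Reasoning
    swap : ∀ a b c → a + b + c ≡ a + c + b
    swap = solve-∀

  -- If p = 2c + 1, then c + 1 is the inverse of 2 modulo p.
  mod-halve : ∀ c {x y} → p ≡ 2 * c + 1 → 2 * x ≅ 2 * y [mod p ] → x ≅ y [mod p ]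
  mod-halve c {x} {y} refl (congruent k l eq) = congruent (x + suc c * k) (y + suc c * l) (begin
    x + (x + suc c * k) * (2 * c + 1)   ≡⟨ expand x k c ⟩
    suc c * (2 * x + k * (2 * c + 1))   ≡⟨ cong (suc c *_) eq ⟩
    suc c * (2 * y + l * (2 * c + 1))   ≡⟨ expand y l c ⟨
    y + (y + suc c * l) * (2 * c + 1)   ∎)
    where
    open ≡-Reasoning
    expand : ∀ x k c → x + (x + suc c * k) * (2 * c + 1) ≡ suc c * (2 * x + k * (2 * c + 1))
    expand = solve-∀

  mod⇒%≡% : ∀ {x y} .{{_ : NonZero p}} → x ≅ y [mod p ] → x % p ≡ y % p
  mod⇒%≡% {x} {y} (congruent k l eq) = begin
    x % p             ≡⟨ [m+kn]%n≡m%n x k p ⟨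
    (x + k * p) % p   ≡⟨ cong (_% p) eq ⟩
    (y + l * p) % p   ≡⟨ [m+kn]%n≡m%n y l p ⟩
    y % p             ∎
    where open ≡-Reasoning

  -- Exponents of `w` are reduced modulo N but labels modulo p; the reductions are compatible
  -- because p divides N.
  %-mod : ∀ x N .{{_ : NonZero N}} h → N ≡ h * p → x % N ≅ x [mod p ]
  %-mod x N h N≡hp = congruent (x / N * h) 0 (begin
    x % N + x / N * h * p     ≡⟨ cong (x % N +_) (ℕₚ.*-assoc (x / N) h p) ⟩
    x % N + x / N * (h * p)   ≡⟨ cong (λ y → x % N + x / N * y) N≡hp ⟨
    x % N + x / N * N         ≡⟨ m≡m%n+[m/n]*n x N ⟨
    x                         ≡⟨ ℕₚ.+-identityʳ x ⟨
    x + 0 * p                 ∎)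
    where open ≡-Reasoning

-- Powers of a primitive element.

module FieldProperties {n N : ℕ} .{{_ : NonZero N}} (F : FiniteField n) (n≡1+N : n ≡ suc N)
         (w : FiniteField.Carrier F) (w-primitive : FiniteField.IsPrimitive F w) where
  open FiniteField F renaming (_+_ to _+ᶠ_; _*_ to _*ᶠ_; _^_ to _^ᶠ_)
  open Exp semiring using (^-homo-*; ^-assocʳ)

  *-cancelˡ-nonZero : ∀ {x y z} → x ≢ 0# → x *ᶠ y ≡ x *ᶠ z → y ≡ z
  *-cancelˡ-nonZero {x} {y} {z} x≢0 eq with x⁻¹ , xx⁻¹≡1 ← inverse x x≢0 = begin
    y                   ≡⟨ cancel y ⟨
    x⁻¹ *ᶠ (x *ᶠ y)     ≡⟨ cong (x⁻¹ *ᶠ_) eq ⟩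
    x⁻¹ *ᶠ (x *ᶠ z)     ≡⟨ cancel z ⟩
    z                   ∎
    where
    open ≡-Reasoning
    cancel : ∀ y → x⁻¹ *ᶠ (x *ᶠ y) ≡ y
    cancel y = trans (sym (*-assoc x⁻¹ x y))
      (trans (cong (_*ᶠ y) (trans (*-comm x⁻¹ x) xx⁻¹≡1)) (*-identityˡ y))

  w^≢0 : ∀ i → w ^ᶠ i ≢ 0#
  w^≢0 i = ^-nonZero i (proj₁ w-primitive)

  private
    -- The visible successor lets `punchIn` and `punchOut` at the index of `0#` enumerate the
    -- nonzero elements by `Fin N`.
    to′ : Carrier → Fin (suc N)
    to′ x = subst Fin n≡1+N (Inverse.to enum x)
    from′ : Fin (suc N) → Carrier
    from′ i = Inverse.from enum (subst Fin (sym n≡1+N) i)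
    from′-to′ : ∀ x → from′ (to′ x) ≡ x
    from′-to′ x = trans (cong (Inverse.from enum) (subst-sym-subst n≡1+N)) (Inverse.strictlyInverseʳ enum x)
    to′-from′ : ∀ i → to′ (from′ i) ≡ i
    to′-from′ i = trans (cong (subst Fin n≡1+N) (Inverse.strictlyInverseˡ enum _)) (subst-subst-sym n≡1+N)
    to′-injective : ∀ {x y} → to′ x ≡ to′ y → x ≡ y
    to′-injective {x} {y} eq = trans (sym (from′-to′ x)) (trans (cong from′ eq) (from′-to′ y))

    power-difference : ∀ {i j} → i ≤ j → w ^ᶠ i ≡ w ^ᶠ j → w ^ᶠ (j ∸ i) ≡ 1#
    power-difference {i} {j} i≤j eq = *-cancelˡ-nonZero (w^≢0 i) (begin
      w ^ᶠ i *ᶠ w ^ᶠ (j ∸ i)   ≡⟨ ^-homo-* w i (j ∸ i) ⟨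
      w ^ᶠ (i + (j ∸ i))       ≡⟨ cong (w ^ᶠ_) (m+[n∸m]≡n i≤j) ⟩
      w ^ᶠ j                   ≡⟨ eq ⟨
      w ^ᶠ i                   ≡⟨ *-identityʳ (w ^ᶠ i) ⟨
      w ^ᶠ i *ᶠ 1#             ∎)
      where open ≡-Reasoning

    1^ : ∀ k → 1# ^ᶠ k ≡ 1#
    1^ zero    = refl
    1^ (suc k) = trans (*-identityˡ _) (1^ k)

    ^-% : ∀ k .{{_ : NonZero k}} → w ^ᶠ k ≡ 1# → ∀ i → w ^ᶠ (i % k) ≡ w ^ᶠ i
    ^-% k w^k≡1 i = sym (begin
      w ^ᶠ i
        ≡⟨ cong (w ^ᶠ_) (trans (m≡m%n+[m/n]*n i k) (cong (i % k +_) (ℕₚ.*-comm (i / k) k))) ⟩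
      w ^ᶠ (i % k + k * (i / k))               ≡⟨ ^-homo-* w (i % k) (k * (i / k)) ⟩
      w ^ᶠ (i % k) *ᶠ w ^ᶠ (k * (i / k))       ≡⟨ cong (w ^ᶠ (i % k) *ᶠ_) (^-assocʳ w k (i / k)) ⟨
      w ^ᶠ (i % k) *ᶠ (w ^ᶠ k) ^ᶠ (i / k)      ≡⟨ cong (λ x → w ^ᶠ (i % k) *ᶠ x ^ᶠ (i / k)) w^k≡1 ⟩
      w ^ᶠ (i % k) *ᶠ 1# ^ᶠ (i / k)            ≡⟨ cong (w ^ᶠ (i % k) *ᶠ_) (1^ (i / k)) ⟩
      w ^ᶠ (i % k) *ᶠ 1#                       ≡⟨ *-identityʳ _ ⟩
      w ^ᶠ (i % k)                             ∎)
      where open ≡-Reasoning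

    -- If w^k = 1, every nonzero element is a power of `w` with exponent below `k`, so the N nonzero
    -- elements inject into `Fin k`.
    order-≥ : ∀ k → .{{_ : NonZero k}} → w ^ᶠ k ≡ 1# → N ≤ k
    order-≥ k w^k≡1 = injective⇒≤ {f = f} f-injective
      where
      x : Fin N → Carrier
      x i = from′ (punchIn (to′ 0#) i)
      x≢0 : ∀ i → x i ≢ 0#
      x≢0 i eq = punchInᵢ≢i (to′ 0#) i (trans (sym (to′-from′ _)) (cong to′ eq))
      log : Fin N → ℕ
      log i = proj₁ (proj₂ w-primitive (x i) (x≢0 i))
      f : Fin N → Fin k
      f i = fromℕ< (m%n<n (log i) k)
      x≡ : ∀ i → x i ≡ w ^ᶠ toℕ (f i)
      x≡ i = trans (proj₂ (proj₂ w-primitive (x i) (x≢0 i)))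
        (sym (trans (cong (w ^ᶠ_) (Finₚ.toℕ-fromℕ< (m%n<n (log i) k))) (^-% k w^k≡1 (log i))))
      f-injective : ∀ {i j} → f i ≡ f j → i ≡ j
      f-injective {i} {j} eq = Finₚ.punchIn-injective (to′ 0#) i j
        (trans (sym (to′-from′ _)) (trans (cong to′ xᵢ≡xⱼ) (to′-from′ _)))
        where
        xᵢ≡xⱼ : x i ≡ x j
        xᵢ≡xⱼ = trans (x≡ i) (trans (cong (λ y → w ^ᶠ toℕ y) eq) (sym (x≡ j)))

    0≢w^ : ∀ (i : Fin (suc N)) → to′ 0# ≢ to′ (w ^ᶠ toℕ i)
    0≢w^ i eq = w^≢0 (toℕ i) (sym (to′-injective eq))

  -- The N + 1 powers with exponents 0 to N lie among N nonzero elements, so two coincide. The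
  -- difference of their exponents is at most N, and at least N by `order-≥`.
  w^N≡1 : w ^ᶠ N ≡ 1#
  w^N≡1 with i , j , i<j , eq ← pigeonhole (n<1+n N) (λ (i : Fin (suc N)) → punchOut (0≢w^ i))
    = subst (λ k → w ^ᶠ k ≡ 1#) (≤-antisym k≤N N≤k) w^k≡1
    where
    w^k≡1 : w ^ᶠ (toℕ j ∸ toℕ i) ≡ 1#
    w^k≡1 = power-difference (<⇒≤ i<j) (to′-injective (punchOut-injective (0≢w^ i) (0≢w^ j) eq))
    k≤N : toℕ j ∸ toℕ i ≤ N
    k≤N = ≤-trans (m∸n≤m (toℕ j) (toℕ i)) (s≤s⁻¹ (toℕ<n j))
    N≤k : N ≤ toℕ j ∸ toℕ i
    N≤k = order-≥ _ {{>-nonZero (m<n⇒0<n∸m i<j)}} w^k≡1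

  w^-% : ∀ i → w ^ᶠ (i % N) ≡ w ^ᶠ i
  w^-% = ^-% N w^N≡1

  -- Equal powers with distinct exponents would give a positive exponent below N with value 1,
  -- against `order-≥`.
  w^-injective : ∀ {i j} → i < N → j < N → w ^ᶠ i ≡ w ^ᶠ j → i ≡ j
  w^-injective {i} {j} i<N j<N eq with <-cmp i j
  ... | tri< i<j _ _ = contradiction (order-≥ (j ∸ i) {{>-nonZero (m<n⇒0<n∸m i<j)}} (power-difference (<⇒≤ i<j) eq))
                         (<⇒≱ (≤-<-trans (m∸n≤m j i) j<N))
  ... | tri≈ _ i≡j _ = i≡j
  ... | tri> _ _ j<i = contradiction (order-≥ (i ∸ j) {{>-nonZero (m<n⇒0<n∸m j<i)}} (power-difference (<⇒≤ j<i) (sym eq)))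
                         (<⇒≱ (≤-<-trans (m∸n≤m i j) i<N))

  discreteLog : ∀ x → x ≢ 0# → ∃ λ (i : Fin N) → x ≡ w ^ᶠ toℕ i
  discreteLog x x≢0 with i , x≡w^i ← proj₂ w-primitive x x≢0 =
    fromℕ< (m%n<n i N) , trans x≡w^i (sym (trans (cong (w ^ᶠ_) (Finₚ.toℕ-fromℕ< (m%n<n i N))) (w^-% i)))

-- Indicators of vertex sets.

member : ∀ {n} → Subset n → Fin n → ℕ
member S u = if lookup S u then 1 else 0

member∈01 : ∀ {n} (S : Subset n) u → member S u ≡ 0 ⊎ member S u ≡ 1
member∈01 S u with lookup S u
... | true  = inj₂ refl
... | false = inj₁ refl

member≡1⇒lookup : ∀ {n} (S : Subset n) u → member S u ≡ 1 → lookup S u ≡ true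
member≡1⇒lookup S u eq with lookup S u
... | true = refl

∑-member : ∀ {n} (S : Subset n) → sum (member S) ≡ ∣ S ∣
∑-member []          = refl
∑-member (true ∷ S)  = cong suc (∑-member S)
∑-member (false ∷ S) = ∑-member S

-- Adjacency in homogeneous coordinates.

module MarušičScapellato
  (a p : ℕ) .{{_ : NonZero p}} (F : FiniteField (2 ^ a)) (w : FiniteField.Carrier F)
  (w-primitive : FiniteField.IsPrimitive F w) where

  N = 2 ^ a ∸ 1

  -- `c` records that p is odd, which allows halving modulo p; `h` is the number of exponents below
  -- N in one class modulo p and becomes the codegree bound.
  module _ {{_ : NonZero N}} {c h : ℕ} (p≡2c+1 : p ≡ 2 * c + 1) (N≡hp : N ≡ h * p) where

    open FiniteField F hiding (_≟ᶠ_) renaming (_+_ to _+ᶠ_; _*_ to _*ᶠ_; _^_ to _^ᶠ_)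
    open CommutativeRing commutativeRing using (commutativeSemiring)
    open Exp semiring using (^-homo-*)

    private
      2^a≡1+N : 2 ^ a ≡ suc N
      2^a≡1+N = sym (ℕₚ.m+[n∸m]≡n (ℕₚ.m^n>0 2 a))

    open FieldProperties F 2^a≡1+N w w-primitive

    Point : Set
    Point = Maybe Carrier

    -- Homogeneous coordinates on the projective line, with ∞ as (1 : 0).
    coord₁ coord₂ : Point → Carrier
    coord₁ nothing  = 1#
    coord₁ (just x) = x
    coord₂ nothing  = 0#
    coord₂ (just _) = 1#

    -- In characteristic 2 the sign of the determinant is immaterial.
    det : Point → Point → Carrier
    det x y = coord₁ x *ᶠ coord₂ y +ᶠ coord₂ x *ᶠ coord₁ y

    det-just : ∀ x y → det (just x) (just y) ≡ x +ᶠ y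
    det-just x y = cong₂ _+ᶠ_ (*-identityʳ x) (*-identityˡ y)

    det-nothing-just : ∀ y → det nothing (just y) ≡ 1#
    det-nothing-just y = trans (cong₂ _+ᶠ_ (*-identityˡ 1#) (zeroˡ y)) (+-identityʳ 1#)

    det-just-nothing : ∀ y → det (just y) nothing ≡ 1#
    det-just-nothing y = trans (cong₂ _+ᶠ_ (zeroʳ y) (*-identityˡ 1#)) (+-identityˡ 1#)

    x+[x+y]≡y : ∀ x y → x +ᶠ (x +ᶠ y) ≡ y
    x+[x+y]≡y x y = trans (sym (+-assoc x x y)) (trans (cong (_+ᶠ y) (x+x≡0 a F x)) (+-identityˡ y))

    x+[y+y]≡x : ∀ x y → x +ᶠ (y +ᶠ y) ≡ x
    x+[y+y]≡x x y = trans (cong (x +ᶠ_) (x+x≡0 a F y)) (+-identityʳ x)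

    x+y≡0⇒x≡y : ∀ {x y} → x +ᶠ y ≡ 0# → x ≡ y
    x+y≡0⇒x≡y {x} {y} eq = begin
      x                 ≡⟨ x+[y+y]≡x x y ⟨
      x +ᶠ (y +ᶠ y)     ≡⟨ +-assoc x y y ⟨
      x +ᶠ y +ᶠ y       ≡⟨ cong (_+ᶠ y) eq ⟩
      0# +ᶠ y           ≡⟨ +-identityˡ y ⟩
      y                 ∎
      where open ≡-Reasoning

    det≡0⇒≡ : ∀ x y → det x y ≡ 0# → x ≡ y
    det≡0⇒≡ nothing  nothing  _  = refl
    det≡0⇒≡ nothing  (just y) eq = contradiction (trans (sym eq) (det-nothing-just y)) 0≢1
    det≡0⇒≡ (just x) nothing  eq = contradiction (trans (sym eq) (det-just-nothing x)) 0≢1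
    det≡0⇒≡ (just x) (just y) eq = cong just (x+y≡0⇒x≡y (trans (sym (det-just x y)) eq))

    -- The three-term Plücker relation. Over a commutative semiring it holds only up to a doubled
    -- term, so `identity` carries `R +ᶠ R` explicitly and characteristic 2 removes it.
    plücker : ∀ x x′ y y′ → det x y *ᶠ det x′ y′ ≡ det x y′ *ᶠ det x′ y → det x x′ *ᶠ det y y′ ≡ 0#
    plücker x x′ y y′ eq = begin
      det x x′ *ᶠ det y y′                               ≡⟨ x+[y+y]≡x _ R ⟨
      det x x′ *ᶠ det y y′ +ᶠ (R +ᶠ R)                   ≡⟨ identity (coord₁ x) (coord₂ x) (coord₁ x′) (coord₂ x′)
                                                              (coord₁ y) (coord₂ y) (coord₁ y′) (coord₂ y′) ⟨
      det x y *ᶠ det x′ y′ +ᶠ det x y′ *ᶠ det x′ y       ≡⟨ cong (_+ᶠ det x y′ *ᶠ det x′ y) eq ⟩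
      det x y′ *ᶠ det x′ y +ᶠ det x y′ *ᶠ det x′ y       ≡⟨ x+x≡0 a F _ ⟩
      0#                                                 ∎
      where
      open ≡-Reasoning
      R = coord₁ x *ᶠ coord₁ x′ *ᶠ (coord₂ y *ᶠ coord₂ y′) +ᶠ coord₂ x *ᶠ coord₂ x′ *ᶠ (coord₁ y *ᶠ coord₁ y′)
      open Solver commutativeSemiring using (solve; _:+_; _:*_; _:=_)
      identity : ∀ a b a′ b′ c d c′ d′ →
        (a *ᶠ d +ᶠ b *ᶠ c) *ᶠ (a′ *ᶠ d′ +ᶠ b′ *ᶠ c′) +ᶠ (a *ᶠ d′ +ᶠ b *ᶠ c′) *ᶠ (a′ *ᶠ d +ᶠ b′ *ᶠ c) ≡
        (a *ᶠ b′ +ᶠ b *ᶠ a′) *ᶠ (c *ᶠ d′ +ᶠ d *ᶠ c′) +ᶠ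
        ((a *ᶠ a′ *ᶠ (d *ᶠ d′) +ᶠ b *ᶠ b′ *ᶠ (c *ᶠ c′)) +ᶠ (a *ᶠ a′ *ᶠ (d *ᶠ d′) +ᶠ b *ᶠ b′ *ᶠ (c *ᶠ c′)))
      identity = solve 8 (λ a b a′ b′ c d c′ d′ →
        (a :* d :+ b :* c) :* (a′ :* d′ :+ b′ :* c′) :+ (a :* d′ :+ b :* c′) :* (a′ :* d :+ b′ :* c) :=
        (a :* b′ :+ b :* a′) :* (c :* d′ :+ d :* c′) :+
        ((a :* a′ :* (d :* d′) :+ b :* b′ :* (c :* c′)) :+ (a :* a′ :* (d :* d′) :+ b :* b′ :* (c :* c′)))) refl

    Vertex : Set
    Vertex = Γ-Vertex a p F w

    infix 4 _~_
    _~_ : Vertex → Vertex → Set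
    _~_ = Γ-Adj a p F w

    ~⇒≢point : ∀ {x r y t} → (x , r) ~ (y , t) → x ≢ y
    ~⇒≢point {just x} (i , eq , _) refl = w^≢0 (toℕ i) (+-cancelʳ′ {x} _ (sym eq))

    +ᶠ-cancelˡ : ∀ x {y z} → x +ᶠ y ≡ x +ᶠ z → y ≡ z
    +ᶠ-cancelˡ x {y} {z} eq =
      trans (sym (x+[x+y]≡y x y)) (trans (cong (x +ᶠ_) eq) (x+[x+y]≡y x z))

    -- Between finite points, x + y fixes the power of `w`, hence the exponent below N, hence the
    -- label.
    ~-functional : ∀ {x r y t t′} → (x , r) ~ (y , t) → (x , r) ~ (y , t′) → t ≡ t′
    ~-functional {nothing} {r} {just _}  eq eq′ = trans eq (sym eq′)
    ~-functional {just _}  {r} {nothing} eq eq′ = trans eq (sym eq′)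
    ~-functional {just x}  {r} {just y}  (i , eq , t≡) (j , eq′ , t′≡) =
      trans t≡ (trans (cong (-r+2i r) i≡j) (sym t′≡))
      where
      i≡j : toℕ i ≡ toℕ j
      i≡j = w^-injective (toℕ<n i) (toℕ<n j) (+ᶠ-cancelˡ x (trans (sym eq) eq′))

    -- With `~-functional`, this yields the perfect matching between two fibres.
    neighbour : ∀ x r y → x ≢ y → ∃ λ t → (x , r) ~ (y , t)
    neighbour nothing  r nothing  x≢y = contradiction refl x≢y
    neighbour nothing  r (just y) x≢y = r , refl
    neighbour (just x) r nothing  x≢y = r , refl
    neighbour (just x) r (just y) x≢y =
      shift (discreteLog (x +ᶠ y) (x≢y ∘ cong just ∘ x+y≡0⇒x≡y))
      where
      shift : (∃ λ (i : Fin N) → x +ᶠ y ≡ w ^ᶠ toℕ i) → ∃ λ t → (just x , r) ~ (just y , t)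
      shift (i , eq) = -r+2i r (toℕ i) , i , trans (sym (x+[x+y]≡y x y)) (cong (x +ᶠ_) eq) , refl

    -- The sign at ∞ is flipped: this makes ~⇒log uniform in the points.
    label : Vertex → ℕ
    label (nothing , r) = p ∸ toℕ r
    label (just _  , r) = toℕ r

    -- At ∞ the determinant is 1, so the exponent is 0, and the flipped sign makes the labels add up
    -- to p. Between finite points, `-r+2i` is rewritten as a sum of labels.
    ~⇒log : ∀ {x r y t} → (x , r) ~ (y , t) →
            ∃ λ i → i ≤ N × det x y ≡ w ^ᶠ i × label (x , r) + label (y , t) ≅ 2 * i [mod p ]
    ~⇒log {nothing} {r} {just y} refl =
      0 , z≤n , det-nothing-just y ,
      congruent 0 1 (trans (ℕₚ.+-identityʳ _) (trans (ℕₚ.m∸n+n≡m (<⇒≤ (toℕ<n r))) (sym (ℕₚ.+-identityʳ p))))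
    ~⇒log {just x} {r} {nothing} refl =
      0 , z≤n , det-just-nothing x ,
      congruent 0 1 (trans (ℕₚ.+-identityʳ _) (trans (ℕₚ.m+[n∸m]≡n (<⇒≤ (toℕ<n r))) (sym (ℕₚ.+-identityʳ p))))
    ~⇒log {just x} {r} {just y} {t} (i , y≡x+w^i , t≡) =
      toℕ i , <⇒≤ (toℕ<n i) , trans (det-just x y) x+y≡w^i , congruent (X / p) 1 (begin
        toℕ r + toℕ t + X / p * p       ≡⟨ cong (λ t → toℕ r + toℕ t + X / p * p) t≡ ⟩
        toℕ r + toℕ (X mod p) + X / p * p     ≡⟨ cong (λ t → toℕ r + t + X / p * p) (Finₚ.toℕ-fromℕ< (m%n<n X p)) ⟩
        toℕ r + X % p + X / p * p       ≡⟨ ℕₚ.+-assoc (toℕ r) (X % p) (X / p * p) ⟩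
        toℕ r + (X % p + X / p * p)     ≡⟨ cong (toℕ r +_) (m≡m%n+[m/n]*n X p) ⟨
        toℕ r + (p ∸ toℕ r + 2 * toℕ i) ≡⟨ ℕₚ.+-assoc (toℕ r) _ _ ⟨
        toℕ r + (p ∸ toℕ r) + 2 * toℕ i ≡⟨ cong (_+ 2 * toℕ i) (ℕₚ.m+[n∸m]≡n (<⇒≤ (toℕ<n r))) ⟩
        p + 2 * toℕ i                   ≡⟨ comm p (2 * toℕ i) ⟩
        2 * toℕ i + 1 * p               ∎)
      where
      open ≡-Reasoning
      X = p ∸ toℕ r + 2 * toℕ i
      comm : ∀ p x → p + x ≡ x + 1 * p
      comm = solve-∀
      x+y≡w^i : x +ᶠ y ≡ w ^ᶠ toℕ i
      x+y≡w^i = trans (cong (x +ᶠ_) y≡x+w^i) (x+[x+y]≡y x _)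

    -- Common neighbours of two vertices.

    module CommonNeighbours (x : Point) (r : Fin p) (x′ : Point) (r′ : Fin p) where

      -- Since p is odd, the last component says that e mod p depends on (x , r) and (x′ , r′) only.
      ratioLog : ∀ {y t} → (x , r) ~ (y , t) → (x′ , r′) ~ (y , t) →
        ∃ λ e → e < N × det x y ≡ w ^ᶠ e *ᶠ det x′ y × label (x , r) ≅ label (x′ , r′) + 2 * e [mod p ]
      ratioLog {y} {t} u~v u′~v
        with i , i≤N , det≡ , labels ← ~⇒log {x} u~v | j , j≤N , det′≡ , labels′ ← ~⇒log {x′} u′~v
        = e , m%n<n _ N , (begin
            det x y                   ≡⟨ det≡ ⟩
            w ^ᶠ i                    ≡⟨ *-identityʳ _ ⟨
            w ^ᶠ i *ᶠ 1#              ≡⟨ cong (w ^ᶠ i *ᶠ_) w^N≡1 ⟨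
            w ^ᶠ i *ᶠ w ^ᶠ N          ≡⟨ ^-homo-* w i N ⟨
            w ^ᶠ (i + N)              ≡⟨ cong (w ^ᶠ_) split ⟨
            w ^ᶠ (i + (N ∸ j) + j)    ≡⟨ ^-homo-* w (i + (N ∸ j)) j ⟩
            w ^ᶠ (i + (N ∸ j)) *ᶠ w ^ᶠ j ≡⟨ cong₂ _*ᶠ_ (w^-% _) det′≡ ⟨
            w ^ᶠ e *ᶠ det x′ y        ∎)
          , mod-cancelʳ (label (y , t)) (mod-trans labels (mod-sym combined))
        where
        open ≡-Reasoning
        -- Represents i - j: adding N is harmless both for powers of `w`, as w^N = 1, and modulo p,
        -- as p divides N.
        e = (i + (N ∸ j)) % N
        split : i + (N ∸ j) + j ≡ i + N
        split = trans (ℕₚ.+-assoc i (N ∸ j) j) (cong (i +_) (ℕₚ.m∸n+n≡m j≤N))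
        e+j≡i : e + j ≅ i [mod p ]
        e+j≡i = mod-trans (mod-+ (%-mod (i + (N ∸ j)) N h N≡hp) mod-refl)
          (congruent 0 h (trans (ℕₚ.+-identityʳ _) (trans split (cong (i +_) N≡hp))))
        combined : label (x′ , r′) + 2 * e + label (y , t) ≅ 2 * i [mod p ]
        combined = mod-trans (mod-reflexive (swap (label (x′ , r′)) e (label (y , t))))
          (mod-trans (mod-+ labels′ mod-refl)
          (mod-trans (mod-reflexive (factor j e)) (mod-trans (mod-+ e+j≡i e+j≡i) (mod-reflexive (double i)))))
          where
          swap : ∀ a e b → a + 2 * e + b ≡ a + b + 2 * e
          swap = solve-∀
          factor : ∀ j e → 2 * j + 2 * e ≡ e + j + (e + j)
          factor = solve-∀
          double : ∀ i → i + i ≡ 2 * i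
          double = solve-∀

      -- With its residue modulo p fixed, e is determined by `e / p`, and N = h p leaves `h`
      -- possible quotients.
      class : ∀ {y t} → (x , r) ~ (y , t) → (x′ , r′) ~ (y , t) → Fin h
      class u~v u′~v = fromℕ< (m<n*o⇒m/o<n {o = p} (subst (e <_) N≡hp e<N))
        where
        e = proj₁ (ratioLog u~v u′~v)
        e<N = proj₁ (proj₂ (ratioLog u~v u′~v))

      -- Equal residues and equal quotients give e₁ = e₂, so the two determinant ratios agree. By
      -- `plücker`, det x x′ det y y′ = 0, and the first factor is nonzero.
      ratio-injective : x ≢ x′ → ∀ {y y′ e₁ e₂} →
        det x y ≡ w ^ᶠ e₁ *ᶠ det x′ y × label (x , r) ≅ label (x′ , r′) + 2 * e₁ [mod p ] →
        det x y′ ≡ w ^ᶠ e₂ *ᶠ det x′ y′ × label (x , r) ≅ label (x′ , r′) + 2 * e₂ [mod p ] →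
        e₁ / p ≡ e₂ / p → y ≡ y′
      ratio-injective x≢x′ {y} {y′} {e₁} {e₂} (det₁ , mod₁) (det₂ , mod₂) quotients =
        det≡0⇒≡ y y′ (*-nonZero (x≢x′ ∘ det≡0⇒≡ x x′) (plücker x x′ y y′ (begin
          det x y *ᶠ det x′ y′                 ≡⟨ cong (_*ᶠ det x′ y′) det₁ ⟩
          w ^ᶠ e₁ *ᶠ det x′ y *ᶠ det x′ y′     ≡⟨ cong (λ e → w ^ᶠ e *ᶠ det x′ y *ᶠ det x′ y′) e₁≡e₂ ⟩
          w ^ᶠ e₂ *ᶠ det x′ y *ᶠ det x′ y′     ≡⟨ *-assoc _ _ _ ⟩
          w ^ᶠ e₂ *ᶠ (det x′ y *ᶠ det x′ y′)   ≡⟨ cong (w ^ᶠ e₂ *ᶠ_) (*-comm _ _) ⟩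
          w ^ᶠ e₂ *ᶠ (det x′ y′ *ᶠ det x′ y)   ≡⟨ *-assoc _ _ _ ⟨
          w ^ᶠ e₂ *ᶠ det x′ y′ *ᶠ det x′ y     ≡⟨ cong (_*ᶠ det x′ y) det₂ ⟨
          det x y′ *ᶠ det x′ y                 ∎)))
        where
        open ≡-Reasoning
        2e₁≅2e₂ : 2 * e₁ ≅ 2 * e₂ [mod p ]
        2e₁≅2e₂ = mod-cancelʳ (label (x′ , r′)) (mod-trans (mod-reflexive (ℕₚ.+-comm (2 * e₁) _))
          (mod-trans (mod-sym mod₁) (mod-trans mod₂ (mod-reflexive (ℕₚ.+-comm _ (2 * e₂))))))
        e₁≡e₂ : e₁ ≡ e₂
        e₁≡e₂ = begin
          e₁                      ≡⟨ m≡m%n+[m/n]*n e₁ p ⟩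
          e₁ % p + e₁ / p * p     ≡⟨ cong₂ (λ r q → r + q * p) (mod⇒%≡% (mod-halve c p≡2c+1 2e₁≅2e₂)) quotients ⟩
          e₂ % p + e₂ / p * p     ≡⟨ m≡m%n+[m/n]*n e₂ p ⟨
          e₂                      ∎

      class-injective : x ≢ x′ → ∀ {y t y′ t′} u~v u′~v u~v′ u′~v′ →
        class {y} {t} u~v u′~v ≡ class {y′} {t′} u~v′ u′~v′ → y ≡ y′
      class-injective x≢x′ u~v u′~v u~v′ u′~v′ eq =
        ratio-injective x≢x′ (proj₂ (proj₂ (ratioLog u~v u′~v))) (proj₂ (proj₂ (ratioLog u~v′ u′~v′)))
          (trans (sym (Finₚ.toℕ-fromℕ< _)) (trans (cong toℕ eq) (Finₚ.toℕ-fromℕ< _)))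

    -- Degrees and codegrees over the enumerated vertices.

    open FiniteSimpleGraph (Γ a p F w w-primitive) using (order; vertex; adj?)
    open CommonNeighbours using (class; class-injective)

    vertex⁻¹ : Vertex → Fin order
    vertex⁻¹ = Inverse.to (FiniteSimpleGraph.enum (Γ a p F w w-primitive))

    vertex-vertex⁻¹ : ∀ v → vertex (vertex⁻¹ v) ≡ v
    vertex-vertex⁻¹ = Inverse.strictlyInverseʳ (FiniteSimpleGraph.enum (Γ a p F w w-primitive))

    vertex-injective : ∀ {u v} → vertex u ≡ vertex v → u ≡ v
    vertex-injective {u} {v} eq = trans (sym (inv u)) (trans (cong vertex⁻¹ eq) (inv v))
      where inv = Inverse.strictlyInverseˡ (FiniteSimpleGraph.enum (Γ a p F w w-primitive))

    index : Point → Fin (suc (2 ^ a))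
    index nothing  = zero
    index (just x) = suc (Inverse.to enum x)

    index⁻¹ : Fin (suc (2 ^ a)) → Point
    index⁻¹ zero    = nothing
    index⁻¹ (suc i) = just (Inverse.from enum i)

    index-index⁻¹ : ∀ i → index (index⁻¹ i) ≡ i
    index-index⁻¹ zero    = refl
    index-index⁻¹ (suc i) = cong suc (Inverse.strictlyInverseˡ enum i)

    index⁻¹-index : ∀ x → index⁻¹ (index x) ≡ x
    index⁻¹-index nothing  = refl
    index⁻¹-index (just x) = cong just (Inverse.strictlyInverseʳ enum x)

    index-injective : ∀ {x y} → index x ≡ index y → x ≡ y
    index-injective {x} {y} eq = trans (sym (index⁻¹-index x)) (trans (cong index⁻¹ eq) (index⁻¹-index y))

    block : Fin order → Fin (suc (2 ^ a))
    block u = index (proj₁ (vertex u))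

    -- Transfers `~-functional` to indices; the upper bounds on degrees and codegrees rest on it.
    common-block⇒≡ : ∀ u {x y} → vertex u ~ vertex x → vertex u ~ vertex y →
                     proj₁ (vertex x) ≡ proj₁ (vertex y) → x ≡ y
    common-block⇒≡ u {x} {y} u~x u~y eq = vertex-injective (same (vertex u) (vertex x) (vertex y) u~x u~y eq)
      where
      same : ∀ u x y → u ~ x → u ~ y → proj₁ x ≡ proj₁ y → x ≡ y
      same (z , r) (x , t) (x , t′) u~x u~y refl = cong (x ,_) (~-functional {z} {r} {x} u~x u~y)

    block-≢ : ∀ u {v} → vertex u ~ vertex v → block u ≢ block v
    block-≢ u {v} u~v eq = ~⇒≢point {proj₁ (vertex u)} {proj₂ (vertex u)} {proj₁ (vertex v)} u~v (index-injective eq)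

    -- The neighbours of `u` occupy distinct blocks other than its own, and `neighbour` supplies one
    -- in each of these 2^a blocks.
    degree : ∀ u → ∑[ v < order ] ⟦ adj? (vertex u) (vertex v) ⟧ ≡ suc N
    degree u = trans (≤-antisym upper lower) 2^a≡1+N
      where
      upper : ∑[ v < order ] ⟦ adj? (vertex u) (vertex v) ⟧ ≤ 2 ^ a
      upper = count-≤ (λ v → adj? (vertex u) (vertex v)) (λ v u~v → punchOut (block-≢ u {v} u~v))
        (λ {v} {v′} u~v u~v′ eq → common-block⇒≡ u u~v u~v′
          (index-injective (punchOut-injective (block-≢ u {v} u~v) (block-≢ u {v′} u~v′) eq)))
      point : Fin (2 ^ a) → Point
      point j = index⁻¹ (punchIn (block u) j)
      point≢ : ∀ j → proj₁ (vertex u) ≢ point j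
      point≢ j eq = punchInᵢ≢i (block u) j (trans (sym (index-index⁻¹ _)) (cong index (sym eq)))
      nbr : ∀ j → ∃ λ t → vertex u ~ (point j , t)
      nbr j = neighbour (proj₁ (vertex u)) (proj₂ (vertex u)) (point j) (point≢ j)
      g : Fin (2 ^ a) → Fin order
      g j = vertex⁻¹ (point j , proj₁ (nbr j))
      vertex-g : ∀ j → vertex (g j) ≡ (point j , proj₁ (nbr j))
      vertex-g j = vertex-vertex⁻¹ _
      g-injective : ∀ {i j} → g i ≡ g j → i ≡ j
      g-injective {i} {j} eq = Finₚ.punchIn-injective (block u) i j
        (trans (sym (index-index⁻¹ _)) (trans (cong index points) (index-index⁻¹ _)))
        where
        points : point i ≡ point j
        points = cong proj₁ (trans (sym (vertex-g i)) (trans (cong vertex eq) (vertex-g j)))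
      lower : 2 ^ a ≤ ∑[ v < order ] ⟦ adj? (vertex u) (vertex v) ⟧
      lower = count-≥ (λ v → adj? (vertex u) (vertex v)) g g-injective
        (λ j → subst (vertex u ~_) (sym (vertex-g j)) (proj₂ (nbr j)))

    codegree : ∀ u v → Fin order → ℕ
    codegree u v x = ⟦ adj? (vertex u) (vertex x) ⟧ * ⟦ adj? (vertex v) (vertex x) ⟧

    common? : ∀ u v x → Dec (vertex u ~ vertex x × vertex v ~ vertex x)
    common? u v x = adj? (vertex u) (vertex x) ×-dec adj? (vertex v) (vertex x)

    codegree-diagonal : ∀ u → sum (codegree u u) ≡ suc N
    codegree-diagonal u = trans (sum-cong-≗ λ x → idem (adj? (vertex u) (vertex x))) (degree u)
      where
      idem : ∀ {P : Set} (P? : Dec P) → ⟦ P? ⟧ * ⟦ P? ⟧ ≡ ⟦ P? ⟧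
      idem (yes _) = refl
      idem (no  _) = refl

    codegree-≤ : ∀ u v {k} (f : ∀ x → vertex u ~ vertex x × vertex v ~ vertex x → Fin k) →
                 (∀ {x y} c c′ → f x c ≡ f y c′ → x ≡ y) → sum (codegree u v) ≤ k
    codegree-≤ u v {k} f f-injective = subst (_≤ k)
      (sum-cong-≗ λ x → sym (⟦⟧-×-dec (adj? (vertex u) (vertex x)) (adj? (vertex v) (vertex x))))
      (count-≤ (common? u v) f f-injective)

    -- A common neighbour would have two neighbours in one block.
    codegree-block : ∀ u v → block u ≡ block v → u ≢ v → sum (codegree u v) ≤ 0
    codegree-block u v eq u≢v = codegree-≤ u v (λ x c → contradiction c (none x)) (λ {x} c → contradiction c (none x))
      where
      open FiniteSimpleGraph (Γ a p F w w-primitive) using (adj-sym)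
      none : ∀ x → ¬ (vertex u ~ vertex x × vertex v ~ vertex x)
      none x (u~x , v~x) = u≢v (common-block⇒≡ x
        (adj-sym {vertex u} {vertex x} u~x) (adj-sym {vertex v} {vertex x} v~x) (index-injective eq))

    -- `class` maps common neighbours to `Fin h`. Equal classes force the same point, over which `u`
    -- has only one neighbour.
    codegree-≢block : ∀ u v → block u ≢ block v → sum (codegree u v) ≤ h
    codegree-≢block u v blocks≢ = codegree-≤ u v
      (λ x (u~x , v~x) → class (proj₁ (vertex u)) (proj₂ (vertex u)) (proj₁ (vertex v)) (proj₂ (vertex v)) u~x v~x)
      (λ {x} {y} (u~x , v~x) (u~y , v~y) eq → common-block⇒≡ u u~x u~y
        (class-injective (proj₁ (vertex u)) (proj₂ (vertex u)) (proj₁ (vertex v)) (proj₂ (vertex v))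
          (blocks≢ ∘ cong index) u~x v~x u~y v~y eq))

    -- On the diagonal this is the equality p Q + N = N + p Q with Q = N + 1. Within a block the
    -- codegree is 0 and the block term is N; between blocks the codegree term is at most p h = N.
    codegree-bound : ∀ u v →
      p * sum (codegree u v) + N * (∑[ j < suc (2 ^ a) ] (⟦ block u ≟ᶠ j ⟧ * ⟦ block v ≟ᶠ j ⟧)) ≤
      N + p * suc N * ⟦ u ≟ᶠ v ⟧
    -- The sum over `j` collapses to the test whether `u` and `v` share a block.
    codegree-bound u v = subst (λ b → p * sum (codegree u v) + N * b ≤ N + p * suc N * ⟦ u ≟ᶠ v ⟧)
      (sym (∑-indicator (block u) (λ j → ⟦ block v ≟ᶠ j ⟧))) cases
      where
      open ≤-Reasoning
      cases : p * sum (codegree u v) + N * ⟦ block v ≟ᶠ block u ⟧ ≤ N + p * suc N * ⟦ u ≟ᶠ v ⟧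
      cases with u ≟ᶠ v | block v ≟ᶠ block u
      ... | yes refl | no  b≢ = contradiction refl b≢
      ... | yes refl | yes _  = ℕₚ.≤-reflexive (trans (cong (λ x → p * x + N * 1) (codegree-diagonal u)) (e p N))
        where
        e : ∀ p N → p * suc N + N * 1 ≡ N + p * suc N * 1
        e = solve-∀
      ... | no u≢v | yes b = begin
        p * sum (codegree u v) + N * 1   ≡⟨ cong (λ x → p * x + N * 1) (ℕₚ.n≤0⇒n≡0 (codegree-block u v (sym b) u≢v)) ⟩
        p * 0 + N * 1                    ≡⟨ e p N ⟩
        N + p * suc N * 0                ∎
        where
        e : ∀ p N → p * 0 + N * 1 ≡ N + p * suc N * 0
        e = solve-∀
      ... | no u≢v | no b≢ = begin
        p * sum (codegree u v) + N * 0   ≤⟨ ℕₚ.+-monoˡ-≤ (N * 0) (ℕₚ.*-monoʳ-≤ p (codegree-≢block u v (b≢ ∘ sym))) ⟩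
        p * h + N * 0                    ≡⟨ e p h N ⟩
        h * p + p * suc N * 0            ≡⟨ cong (_+ p * suc N * 0) N≡hp ⟨
        N + p * suc N * 0                ∎
        where
        e : ∀ p h N → p * h + N * 0 ≡ h * p + p * suc N * 0
        e = solve-∀

    independent-≤ : ∀ {R} → 2 ^ a ≡ R * R → ∀ {m} →
      HasIndependentSetOfSize (Γ a p F w w-primitive) m → suc R * m ≤ p * suc (2 ^ a)
    independent-≤ {R} 2^a≡R² (S , independent , refl) = subst (λ m → suc R * m ≤ p * suc (2 ^ a)) (∑-member S)
      (IndependentSet.ratioBound {R = R} {p = p}
        -- The transposed order makes the column sums match `degree` and `codegree`.
        (λ x u → ⟦ adj? (vertex u) (vertex x) ⟧) (λ j u → ⟦ block u ≟ᶠ j ⟧) (member S)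
        (trans (sym 2^a≡1+N) 2^a≡R²) (cong suc 2^a≡1+N) (ℕₚ.*-comm p (suc (2 ^ a)))
        degree (λ u → ∑-indicator-1 (block u)) codegree-bound (member∈01 S) nonadjacent)
      where
      nonadjacent : ∀ u v → member S u ≡ 1 → member S v ≡ 1 → ⟦ adj? (vertex v) (vertex u) ⟧ ≡ 0
      nonadjacent u v u∈S v∈S with adj? (vertex v) (vertex u)
      ... | no  _   = refl
      ... | yes v~u = contradiction v~u
        (independent v (lookup⇒[]= v S (member≡1⇒lookup S v v∈S)) u (lookup⇒[]= u S (member≡1⇒lookup S u u∈S)))

-- Fermat exponents and the final comparison.

2^k-even : ∀ k → 1 ≤ k → ∃ λ c → 2 ^ k ≡ 2 * c
2^k-even (suc k) _ = 2 ^ k , refl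

-- As l ≤ s - 1, p is at most R + 1, which cancels to x ≤ q. If x = q, cancelling q instead gives R
-- + 1 ≤ p, and strict growth of 2^(2^l) in l excludes l < s - 1.
ratioBound⇒conclusion : ∀ {s l p q x} → l ≤ s ∸ 1 → p ≡ 2 ^ (2 ^ l) + 1 → 1 ≤ q →
  suc (2 ^ (2 ^ (s ∸ 1))) * x ≤ p * q →
  x ≤ q × (x ≡ q → l ≡ s ∸ 1 × p ≡ 2 ^ (2 ^ (s ∸ 1)) + 1)
ratioBound⇒conclusion {s} {l} {p} {q} {x} l≤s-1 refl 1≤q bound = ℕₚ.*-cancelˡ-≤ (suc R) upper , equality
  where
  R = 2 ^ (2 ^ (s ∸ 1))
  p≤1+R : p ≤ suc R
  p≤1+R = subst (p ≤_) (ℕₚ.+-comm R 1) (ℕₚ.+-monoˡ-≤ 1 (ℕₚ.^-monoʳ-≤ 2 (ℕₚ.^-monoʳ-≤ 2 l≤s-1)))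
  upper : suc R * x ≤ suc R * q
  upper = ≤-trans bound (ℕₚ.*-monoˡ-≤ q p≤1+R)
  equality : x ≡ q → l ≡ s ∸ 1 × p ≡ R + 1
  equality refl = l≡s-1 , cong (λ l → 2 ^ (2 ^ l) + 1) l≡s-1
    where
    1+R≤p : suc R ≤ p
    1+R≤p = ℕₚ.*-cancelʳ-≤ (suc R) p x {{>-nonZero 1≤q}} bound
    l≮s-1 : ¬ l < s ∸ 1
    l≮s-1 l<s-1 = <⇒≱ (ℕₚ.^-monoʳ-< 2 (n<1+n 1) (ℕₚ.^-monoʳ-< 2 (n<1+n 1) l<s-1))
      (s≤s⁻¹ (subst (suc R ≤_) (ℕₚ.+-comm _ 1) 1+R≤p))
    l≡s-1 : l ≡ s ∸ 1
    l≡s-1 = ≤-antisym l≤s-1 (ℕₚ.≮⇒≥ l≮s-1)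

-- Provides the integer square root R of 2^a: the exponent 2^s is twice 2^(s - 1).
square-exponent : ∀ s → 1 ≤ s → 2 ^ (2 ^ s) ≡ 2 ^ (2 ^ (s ∸ 1)) * 2 ^ (2 ^ (s ∸ 1))
square-exponent (suc s) _ =
  trans (cong (λ e → 2 ^ (2 ^ s + e)) (ℕₚ.+-identityʳ (2 ^ s))) (ℕₚ.^-distribˡ-+-* 2 (2 ^ s) (2 ^ s))

theorem5p8 : (s a q p l : ℕ) .{{_ : NonZero p}} →
    1 ≤ s → a ≡ 2 ^ s →
    Prime q → q ≡ 2 ^ a + 1 →
    Prime p → p ∣ 2 ^ a ∸ 1 →
    l ≤ s ∸ 1 → p ≡ 2 ^ (2 ^ l) + 1 →
    (F : FiniteField (2 ^ a)) (w : FiniteField.Carrier F)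
    (w-primitive : FiniteField.IsPrimitive F w) →
    α (Γ a p F w w-primitive) ≤ q ×
    (α (Γ a p F w w-primitive) ≡ q → l ≡ s ∸ 1 × p ≡ 2 ^ (2 ^ (s ∸ 1)) + 1)
theorem5p8 s a q p l 1≤s a≡2^s _ q≡2^a+1 _ (divides h N≡hp) l≤s-1 p≡2^2^l+1 F w w-primitive
  -- The exponent 2^l is positive, so p - 1 = 2c is even; this is the oddness of p used for halving.
  with c , 2^2^l≡2c ← 2^k-even (2 ^ l) (ℕₚ.m^n>0 2 l) =
  ratioBound⇒conclusion {s} l≤s-1 p≡2^2^l+1 (subst (1 ≤_) (sym q≡1+2^a) (s≤s z≤n))
    (subst (λ q → suc R * α G ≤ p * q) (sym q≡1+2^a)
      (MarušičScapellato.independent-≤ a p F w w-primitive {c} {h} (trans p≡2^2^l+1 (cong (_+ 1) 2^2^l≡2c)) N≡hp {R}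
        (trans (cong (2 ^_) a≡2^s) (square-exponent s 1≤s))
        (proj₁ (proj₂ (independenceNumber-exists G)))))
  where
  R = 2 ^ (2 ^ (s ∸ 1))
  G = Γ a p F w w-primitive
  q≡1+2^a : q ≡ suc (2 ^ a)
  q≡1+2^a = trans q≡2^a+1 (ℕₚ.+-comm (2 ^ a) 1)
  instance
    N≢0 : NonZero (2 ^ a ∸ 1)
    N≢0 = >-nonZero (m<n⇒0<n∸m (ℕₚ.^-monoʳ-< 2 (n<1+n 1) (subst (0 <_) (sym a≡2^s) (ℕₚ.m^n>0 2 s))))
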